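{- Let $n,m,k$ be positive integers, $\Lambda=[\lambda_1\dots\lambda_m]^T$ and $R=[r_1\dots r_k]^T$ positive integer vectors, and $H=[h_1\dots h_m]^T$ integers with $1\le h_1<h_2<\dots<h_m\le n$. (a) $\Lambda K_n^H$ is $R$-factorable if and only if $\sum_{i\in[m]}\lambda_i\binom{n-1}{h_i-1}=\sum_{i\in[k]}r_i$ and there exists a non-negative integer $k\times m$ matrix $A=[a_{ij}]$ with $AH=nR$ (i.e. $\sum_{j\in[m]}a_{ij}h_j=nr_i$ for all $i\in[k]$) and $\sum_{i\in[k]}a_{ij}=\lambda_j\binom{n}{h_j}$ for all $j\in[m]$. (b) If $\{F_1,\dots,F_k\}$ is an $R$-factorization of $\Lambda K_n^H$ and $a_{ij}$ denotes the number of edges of size $h_j$ in $F_i$, then $A=[a_{ij}]$ satisfies the conditions in (a), and for each $i\in[k]$ such that $F_i$ is connected, $\sum_{j\in[m]}a_{ij}\le n(r_i-1)+1$. (c) Conversely, if the equality and the matrix $A$ of (a) exist, then there is an $R$-factorization $\{F_1,\dots,F_k\}$ of $\Lambda K_n^H$ in which, for all $i,j$, $F_i$ has exactly $a_{ij}$ edges of size $h_j$, and $F_i$ is connected for every $i\in[k]$ with $\sum_{j\in[m]}a_{ij}\le n(r_i-1)+1$.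
   Context: $\Lambda K_n^H=\bigcup_{i\in[m]}\lambda_iK_n^{h_i}$ is the hypergraph on $n$ vertices in which, for each $i\in[m]$, every $h_i$-element subset of vertices is an edge of multiplicity $\lambda_i$ (and there are no other edges). Degree of a vertex is the number of edges containing it. An $r$-factor is a spanning sub-hypergraph in which every vertex has degree $r$. An $R$-factorization of a hypergraph is a partition $\{F_1,\dots,F_k\}$ of its edge multiset such that $F_i$ (with all vertices) is an $r_i$-factor for each $i\in[k]$. -}

module Defs where

open import Data.Nat using (ℕ; zero; suc; _+_; _*_; _≟_)
open import Data.Fin as F using (Fin; zero; suc)
open import Data.Fin.Subset using (Subset; inside; outside; ∣_∣; _∈_)
open import Data.Fin.Subset.Properties using (_∈?_)
open import Data.Vec using (_∷_; [])
open import Data.Product using (Σ; _×_; ∃-syntax)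
open import Relation.Nullary using (Dec; yes; no)
open import Relation.Binary.PropositionalEquality using (_≡_)
open import Relation.Binary.Construct.Closure.ReflexiveTransitive using (Star)
open import Data.Nat.Combinatorics using (_C_)
open import Data.Nat using (_∸_)

∑ : (n : ℕ) → (Fin n → ℕ) → ℕ
∑ zero    f = 0
∑ (suc n) f = f zero + ∑ n (λ i → f (suc i))

∑Sub : (n : ℕ) → (Subset n → ℕ) → ℕ
∑Sub zero    f = f []
∑Sub (suc n) f = ∑Sub n (λ S → f (outside ∷ S)) + ∑Sub n (λ S → f (inside ∷ S))

ind : ∀ {P : Set} → Dec P → ℕ
ind (yes _) = 1
ind (no _)  = 0

-- The edge multiset of ΛK_n^H (vertex set Fin n) consists of the labelled
-- edges (j , S , c) with S an H j-element subset of Fin n and c : Fin (Λ j)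
-- (the c-th copy of S).  A partition of this multiset into k parts
-- F_0 … F_{k-1} is an assignment of a part to every labelled edge.
-- (Values on subsets S with ∣ S ∣ ≢ H j are irrelevant and ignored.)
Assignment : (n m k : ℕ) → (Λ : Fin m → ℕ) → Set
Assignment n m k Λ = (j : Fin m) → Subset n → Fin (Λ j) → Fin k

module _ {n m k : ℕ} {Λ : Fin m → ℕ} (H : Fin m → ℕ) (f : Assignment n m k Λ) where

  mult : Fin k → (j : Fin m) → Subset n → ℕ
  mult i j S = ∑ (Λ j) (λ c → ind (f j S c F.≟ i))

  degree : Fin k → Fin n → ℕ
  degree i v = ∑ m (λ j → ∑Sub n (λ S → ind (∣ S ∣ ≟ H j) * ind (v ∈? S) * mult i j S))

  edgeCount : Fin k → Fin m → ℕ
  edgeCount i j = ∑Sub n (λ S → ind (∣ S ∣ ≟ H j) * mult i j S)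

  Adjacent : Fin k → Fin n → Fin n → Set
  Adjacent i u v = ∃[ j ] ∃[ S ] ∃[ c ] (∣ S ∣ ≡ H j × f j S c ≡ i × u ∈ S × v ∈ S)

  Connected : Fin k → Set
  Connected i = ∀ u v → Star (Adjacent i) u v

IsRFactorization : {n m k : ℕ} {Λ : Fin m → ℕ} (H : Fin m → ℕ) (R : Fin k → ℕ)
                   → Assignment n m k Λ → Set
IsRFactorization {n} {m} {k} H R f = ∀ i v → degree H f i v ≡ R i

RFactorable : (n m k : ℕ) (Λ H : Fin m → ℕ) (R : Fin k → ℕ) → Set
RFactorable n m k Λ H R = ∃[ f ] IsRFactorization {n} {m} {k} {Λ} H R f

DegreeCond : (n m k : ℕ) (Λ H : Fin m → ℕ) (R : Fin k → ℕ) → Set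
DegreeCond n m k Λ H R = ∑ m (λ j → Λ j * ((n ∸ 1) C (H j ∸ 1))) ≡ ∑ k R

MatrixCond : (n m k : ℕ) (Λ H : Fin m → ℕ) (R : Fin k → ℕ) → (Fin k → Fin m → ℕ) → Set
MatrixCond n m k Λ H R A =
  (∀ i → ∑ m (λ j → A i j * H j) ≡ n * R i) × (∀ j → ∑ k (λ i → A i j) ≡ Λ j * (n C H j))

{-# OPTIONS --safe #-}
module Submission where

-- Amalgamation and detachment.  Start with all vertices fused into a single one of weight n, so that an edge of
-- size h contains it h times, and split the vertices off one at a time.  When the fused vertex has weight p, an
-- edge containing it q times should give a hinge to the new vertex with frequency q / p.  These fractions are
-- rounded simultaneously for two chains of partitions of the hinges: edges and types (size, vertices split off so
-- far) on one side; branches at the fused vertex, nontrivial branches and colours on the other.  A chain of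
-- partitions yields a matching that pairs up each of its classes with at most one exception, the union of two
-- matchings is bipartite, so every set of hinges can be halved evenly in all classes at once; repeatedly halving
-- the union of two classes of a p-colouring makes it equitable, and one of its colours is the rounding.
-- A colour class stays connected as long as its number of branches c satisfies c ≤ p (r − 1) + 1: this
-- forces the nontrivial branches, those with at least two hinges, to have at least p hinges in total when p ≥ 2,
-- so that the new vertex meets one of them, and it never takes all its hinges.
open import Defs
open import Data.Nat
open import Data.Nat.Properties
open import Data.Nat.Combinatorics using (_C_; nCk+nC[k+1]≡[n+1]C[k+1]; k>n⇒nCk≡0)
open import Data.Nat.Induction using (<-wellFounded)
open import Data.Nat.Tactic.RingSolver using (solve-∀)
open import Data.Bool using (Bool; true; false; not; _∧_; if_then_else_)
import Data.Bool.Properties as Bool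
open import Data.Fin as F using (Fin; zero; suc)
import Data.Fin.Properties as Fin
open import Data.Fin.Subset using (Subset; Side; inside; outside; ∣_∣; _∈_)
open import Data.Fin.Subset.Properties using (_∈?_; drop-there)
open import Data.Vec as Vec using ([]; _∷_)
import Data.Vec.Properties as Vec
open import Data.List using (List; []; _∷_; _++_; map; concatMap; tabulate; allFin; replicate; length; lookup; filter)
open import Data.List.Properties using (map-++)
open import Data.List.Membership.Propositional as L using (find; lose)
open import Data.List.Membership.Propositional.Properties using (∈-∃++; ∈-filter⁺)
open import Data.List.Relation.Unary.Any as Any using (Any; here; there; any?)
open import Data.List.Relation.Unary.Any.Properties using (lookup-index)
open import Data.List.Relation.Unary.All as All using (All; []; _∷_)
open import Data.List.Relation.Unary.All.Properties as All using (++⁺; ++⁻ˡ; ++⁻ʳ; ¬All⇒Any¬)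
open import Data.List.Relation.Unary.AllPairs as AllPairs using (AllPairs; []; _∷_)
import Data.List.Relation.Unary.AllPairs.Properties as AllPairs
open import Data.List.Relation.Unary.Unique.Propositional using (Unique)
import Data.List.Relation.Unary.Unique.Propositional.Properties as Unique
open import Data.List.Relation.Binary.Permutation.Propositional
  using (_↭_; prep; swap; ↭-sym; ↭-trans; ↭-refl; ↭-reflexive)
open import Data.List.Relation.Binary.Permutation.Propositional.Properties
  using (shift; shifts; ++-assoc; All-resp-↭) renaming (++⁺ˡ to ↭-++⁺ˡ)
open import Data.Product using (Σ; ∃; _×_; _,_; _,′_; proj₁; proj₂; ∃-syntax)
import Data.Product.Properties as Product
open import Data.Sum using (_⊎_; inj₁; inj₂)
open import Data.Empty using (⊥-elim)
open import Function using (_∘_; id; case_of_)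
open import Function.Bundles using (_⇔_; mk⇔)
open import Induction.WellFounded using (Acc; acc)
open import Relation.Nullary
open import Relation.Nullary.Decidable using (¬?; _⊎-dec_; _×-dec_)
open import Relation.Binary.Definitions using (DecidableEquality)
open import Relation.Binary.Construct.Closure.ReflexiveTransitive as Star using (Star; ε; _◅_; _◅◅_)
open import Relation.Binary.PropositionalEquality

-- Whatever must hold exactly survives the rounding because its fraction is an integer. A colour of
-- degree r has p r hinges at the fused vertex, so its share is r. A type with multiplicity λ whose
-- edges contain the fused vertex x times has x λ C(p, x) = p λ C(p - 1, x - 1) hinges, so its share
-- is λ C(p - 1, x - 1); at weight 0 this leaves exactly λ copies of each set. The obstacle is that
-- evenness is demanded of partitions that do not nest, since types cut across colours and branches.
-- Two chains are what halving can bear: the union of two matchings has only even cycles, whereas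
-- three matchings can form a triangle. Connectivity therefore has to be expressed by classes that
-- fit into the second chain. Single branches do not suffice, because each of their shares may be
-- rounded down to 0; hence the class of all nontrivial branches of a colour. The bound on c comes
-- from connectivity itself: joining p vertices requires the edge sizes less one to add up to at
-- least p - 1, which is p r - c ≥ p - 1. At the start every edge is a branch of its own, so the
-- bound is the hypothesis on the matrix; at weight 0 it says c ≤ 1.

private variable
  A B X : Set

-- Indicators and finite sums

ind-yes : {P : Set} (d : Dec P) → P → ind d ≡ 1
ind-yes (yes _) p = refl
ind-yes (no ¬p) p = ⊥-elim (¬p p)

ind-no : {P : Set} (d : Dec P) → ¬ P → ind d ≡ 0
ind-no (yes p) ¬p = ⊥-elim (¬p p)
ind-no (no _)  ¬p = refl

ind-cong : {P Q : Set} (d : Dec P) (d′ : Dec Q) → (P → Q) → (Q → P) → ind d ≡ ind d′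
ind-cong (yes p) d′ f g = sym (ind-yes d′ (f p))
ind-cong (no ¬p) d′ f g = sym (ind-no d′ (¬p ∘ g))

ind≤1 : {P : Set} (d : Dec P) → ind d ≤ 1
ind≤1 (yes _) = ≤-refl
ind≤1 (no _)  = z≤n

ind>0⇒ : {P : Set} (d : Dec P) → 1 ≤ ind d → P
ind>0⇒ (yes p) _ = p

ind-*-cong : {P : Set} (d : Dec P) {x y : ℕ} → (P → x ≡ y) → ind d * x ≡ ind d * y
ind-*-cong (yes p) f = cong (1 *_) (f p)
ind-*-cong (no _)  f = refl

opaque
  atLeast? : ∀ k n → Dec (k ≤ n)
  atLeast? = _≤?_

sumOver : List A → (A → ℕ) → ℕ
sumOver []       f = 0
sumOver (x ∷ xs) f = f x + sumOver xs f

sumOver-cong : (xs : List A) {f g : A → ℕ} → (∀ x → f x ≡ g x) → sumOver xs f ≡ sumOver xs g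
sumOver-cong []       eq = refl
sumOver-cong (x ∷ xs) eq = cong₂ _+_ (eq x) (sumOver-cong xs eq)

sumOver-mono : (xs : List A) {f g : A → ℕ} → (∀ x → f x ≤ g x) → sumOver xs f ≤ sumOver xs g
sumOver-mono []       le = z≤n
sumOver-mono (x ∷ xs) le = +-mono-≤ (le x) (sumOver-mono xs le)

sumOver-0 : (xs : List A) → sumOver xs (λ _ → 0) ≡ 0
sumOver-0 []       = refl
sumOver-0 (x ∷ xs) = sumOver-0 xs

+-interchange : ∀ a b c d → (a + b) + (c + d) ≡ (a + c) + (b + d)
+-interchange = solve-∀

sumOver-+ : (xs : List A) (f g : A → ℕ) → sumOver xs (λ x → f x + g x) ≡ sumOver xs f + sumOver xs g
sumOver-+ []       f g = refl
sumOver-+ (x ∷ xs) f g =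
  trans (cong (f x + g x +_) (sumOver-+ xs f g)) (+-interchange (f x) (g x) (sumOver xs f) (sumOver xs g))

sumOver-*ˡ : (xs : List A) (c : ℕ) (f : A → ℕ) → sumOver xs (λ x → c * f x) ≡ c * sumOver xs f
sumOver-*ˡ []       c f = sym (*-zeroʳ c)
sumOver-*ˡ (x ∷ xs) c f =
  trans (cong (c * f x +_) (sumOver-*ˡ xs c f)) (sym (*-distribˡ-+ c (f x) (sumOver xs f)))

sumOver-*ʳ : (xs : List A) (f : A → ℕ) (c : ℕ) → sumOver xs (λ x → f x * c) ≡ sumOver xs f * c
sumOver-*ʳ xs f c = trans (sumOver-cong xs (λ x → *-comm (f x) c))
  (trans (sumOver-*ˡ xs c f) (*-comm c _))

sumOver-swap : (xs : List A) (ys : List B) (f : A → B → ℕ) →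
  sumOver xs (λ x → sumOver ys (f x)) ≡ sumOver ys (λ y → sumOver xs (λ x → f x y))
sumOver-swap []       ys f = sym (sumOver-0 ys)
sumOver-swap (x ∷ xs) ys f =
  trans (cong (sumOver ys (f x) +_) (sumOver-swap xs ys f)) (sym (sumOver-+ ys (f x) _))

sumOver-++ : (xs ys : List A) (f : A → ℕ) → sumOver (xs ++ ys) f ≡ sumOver xs f + sumOver ys f
sumOver-++ []       ys f = refl
sumOver-++ (x ∷ xs) ys f = trans (cong (f x +_) (sumOver-++ xs ys f)) (sym (+-assoc (f x) _ _))

sumOver-map : (g : A → B) (xs : List A) (f : B → ℕ) → sumOver (map g xs) f ≡ sumOver xs (f ∘ g)
sumOver-map g []       f = refl
sumOver-map g (x ∷ xs) f = cong (f (g x) +_) (sumOver-map g xs f)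

sumOver-concatMap : (g : A → List B) (xs : List A) (f : B → ℕ) →
  sumOver (concatMap g xs) f ≡ sumOver xs (λ x → sumOver (g x) f)
sumOver-concatMap g []       f = refl
sumOver-concatMap g (x ∷ xs) f =
  trans (sumOver-++ (g x) (concatMap g xs) f) (cong (sumOver (g x) f +_) (sumOver-concatMap g xs f))

sumOver-replicate : (n : ℕ) (x : A) (f : A → ℕ) → sumOver (replicate n x) f ≡ n * f x
sumOver-replicate zero    x f = refl
sumOver-replicate (suc n) x f = cong (f x +_) (sumOver-replicate n x f)

sumOver-filter : {P : A → Set} (P? : ∀ x → Dec (P x)) (xs : List A) (f : A → ℕ) →
  sumOver (filter P? xs) f ≡ sumOver xs (λ x → ind (P? x) * f x)
sumOver-filter P? [] f = refl
sumOver-filter P? (x ∷ xs) f with P? x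
... | yes _ = cong₂ _+_ (sym (+-identityʳ (f x))) (sumOver-filter P? xs f)
... | no _  = sumOver-filter P? xs f

sumOver-↭ : {xs ys : List A} (f : A → ℕ) → xs ↭ ys → sumOver xs f ≡ sumOver ys f
sumOver-↭ f _↭_.refl = refl
sumOver-↭ f (prep x p) = cong (f x +_) (sumOver-↭ f p)
sumOver-↭ f (swap {xs} {ys} x y p) = trans (cong (λ z → f x + (f y + z)) (sumOver-↭ f p))
  (lem (f x) (f y) (sumOver ys f))
  where lem : ∀ a b c → a + (b + c) ≡ b + (a + c)
        lem = solve-∀
sumOver-↭ f (_↭_.trans p q) = trans (sumOver-↭ f p) (sumOver-↭ f q)

sumOver-<⇒∃ : (xs : List A) (f g : A → ℕ) → sumOver xs f < sumOver xs g → ∃ λ x → x L.∈ xs × f x < g x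
sumOver-<⇒∃ (x ∷ xs) f g lt with f x <? g x
... | yes p = x , here refl , p
... | no ¬p with sumOver-<⇒∃ xs f g (+-cancelˡ-< (f x) _ _ (<-≤-trans lt (+-monoˡ-≤ _ (≮⇒≥ ¬p))))
...   | y , y∈ , p = y , there y∈ , p

sumOver>0⇒∃ : (xs : List A) (f : A → ℕ) → 1 ≤ sumOver xs f → ∃ λ x → x L.∈ xs × 1 ≤ f x
sumOver>0⇒∃ xs f pos = sumOver-<⇒∃ xs (λ _ → 0) f (subst (_< sumOver xs f) (sym (sumOver-0 xs)) pos)

∈⇒≤sumOver : {x : A} (xs : List A) (f : A → ℕ) → x L.∈ xs → f x ≤ sumOver xs f
∈⇒≤sumOver (x ∷ xs) f (here refl) = m≤m+n (f x) _
∈⇒≤sumOver (x ∷ xs) f (there p) = ≤-trans (∈⇒≤sumOver xs f p) (m≤n+m _ (f x))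

sumOver-tabulate : ∀ {n} (g : Fin n → A) (f : A → ℕ) → sumOver (tabulate g) f ≡ ∑ n (f ∘ g)
sumOver-tabulate {n = zero}  g f = refl
sumOver-tabulate {n = suc n} g f = cong (f (g zero) +_) (sumOver-tabulate (g ∘ suc) f)

∑≡sumOver : ∀ n (f : Fin n → ℕ) → ∑ n f ≡ sumOver (allFin n) f
∑≡sumOver n f = sym (sumOver-tabulate id f)

sumOver-lookup : (xs : List A) (f : A → ℕ) → sumOver (allFin (length xs)) (f ∘ lookup xs) ≡ sumOver xs f
sumOver-lookup xs f = trans (sym (∑≡sumOver (length xs) _)) (go xs)
  where
  go : ∀ ys → ∑ (length ys) (f ∘ lookup ys) ≡ sumOver ys f
  go []       = refl
  go (y ∷ ys) = cong (f y +_) (go ys)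

-- Every element of A occurs exactly once in xs.
Enumerates : List A → DecidableEquality A → Set
Enumerates {A} xs _≟_ = ∀ (a : A) (f : A → ℕ) → sumOver xs (λ x → ind (x ≟ a) * f x) ≡ f a

allFin-enumerates : ∀ n → Enumerates (allFin n) F._≟_
allFin-enumerates n a f = trans (sym (∑≡sumOver n _)) (go n a f)
  where
  go : ∀ n (a : Fin n) (f : Fin n → ℕ) → ∑ n (λ x → ind (x F.≟ a) * f x) ≡ f a
  go (suc n) zero f = trans (cong (1 * f zero +_)
      (trans (∑≡sumOver n _) (sumOver-0 (allFin n)))) (lem (f zero))
    where lem : ∀ x → 1 * x + 0 ≡ x
          lem = solve-∀
  go (suc n) (suc a) f = trans (trans (∑≡sumOver n _) (trans (sumOver-cong (allFin n)
      (λ x → cong (_* f (suc x)) (ind-cong (suc x F.≟ suc a) (x F.≟ a) (λ { refl → refl }) (cong suc))))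
      (sym (∑≡sumOver n _)))) (go n a (f ∘ suc))

module Enumeration {xs : List A} {_≟ᴬ_ : DecidableEquality A} (enum : Enumerates xs _≟ᴬ_) where

  enum-sym : ∀ a (f : A → ℕ) → sumOver xs (λ x → ind (a ≟ᴬ x) * f x) ≡ f a
  enum-sym a f = trans (sumOver-cong xs λ x → cong (_* f x) (ind-cong (a ≟ᴬ x) (x ≟ᴬ a) sym sym)) (enum a f)

  enum-one : ∀ a → sumOver xs (λ x → ind (x ≟ᴬ a)) ≡ 1
  enum-one a = trans (sumOver-cong xs λ x → sym (*-identityʳ _)) (enum a (λ _ → 1))

  enum-one-sym : ∀ a → sumOver xs (λ x → ind (a ≟ᴬ x)) ≡ 1
  enum-one-sym a = trans (sumOver-cong xs λ x → sym (*-identityʳ _)) (enum-sym a (λ _ → 1))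

  ∈-enum : ∀ a → a L.∈ xs
  ∈-enum a with sumOver>0⇒∃ xs _ (≤-reflexive (sym (enum-one a)))
  ... | x , x∈ , p = subst (L._∈ xs) (ind>0⇒ (x ≟ᴬ a) p) x∈

  ≤sumOver : ∀ a (f : A → ℕ) → f a ≤ sumOver xs f
  ≤sumOver a f = ∈⇒≤sumOver xs f (∈-enum a)

  sumOver-fibres : {B : Set} (ys : List B) (g : B → A) (f : A → ℕ) →
    sumOver xs (λ x → sumOver ys (λ y → ind (g y ≟ᴬ x)) * f x) ≡ sumOver ys (f ∘ g)
  sumOver-fibres ys g f = trans (sumOver-cong xs λ x → sym (sumOver-*ʳ ys _ (f x)))
    (trans (sumOver-swap xs ys _) (sumOver-cong ys λ y → enum-sym (g y) f))

module FinSum (n : ℕ) = Enumeration {xs = allFin n} {F._≟_} (allFin-enumerates n)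

-- Two-colouring the union of two matchings

flat : List (X × X) → List X
flat = concatMap (λ (x , y) → x ∷ y ∷ [])

flat-++ : (M N : List (X × X)) → flat (M ++ N) ≡ flat M ++ flat N
flat-++ []            N = refl
flat-++ ((x , y) ∷ M) N = cong (λ l → x ∷ y ∷ l) (flat-++ M N)

Proper : (X → Bool) → List (X × X) → Set
Proper χ = All (λ (x , y) → χ x ≡ not (χ y))

Unique-↭ : {xs ys : List X} → xs ↭ ys → Unique xs → Unique ys
Unique-↭ _↭_.refl u = u
Unique-↭ (prep x p) (x∉ ∷ u) = All-resp-↭ p x∉ ∷ Unique-↭ p u
Unique-↭ (swap x y p) ((x≢y ∷ x∉) ∷ y∉ ∷ u) =
  ((x≢y ∘ sym) ∷ All-resp-↭ p y∉) ∷ All-resp-↭ p x∉ ∷ Unique-↭ p u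
Unique-↭ (_↭_.trans p q) u = Unique-↭ q (Unique-↭ p u)

Unique-++ˡ : (xs : List X) {ys : List X} → Unique (xs ++ ys) → Unique xs
Unique-++ˡ []       u        = []
Unique-++ˡ (x ∷ xs) (p ∷ u) = ++⁻ˡ xs p ∷ Unique-++ˡ xs u

module TwoColouring {X : Set} (_≟ˣ_ : DecidableEquality X) where

  _[_≔_,_≔_] : (X → Bool) → X → Bool → X → Bool → X → Bool
  (χ [ x ≔ β , y ≔ γ ]) z with z ≟ˣ x | z ≟ˣ y
  ... | yes _ | _     = β
  ... | no _  | yes _ = γ
  ... | no _  | no _  = χ z

  module _ (χ : X → Bool) {x y : X} {β γ : Bool} where

    upd-first : (χ [ x ≔ β , y ≔ γ ]) x ≡ β
    upd-first with x ≟ˣ x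
    ... | yes _ = refl
    ... | no ¬p = ⊥-elim (¬p refl)

    upd-second : x ≢ y → (χ [ x ≔ β , y ≔ γ ]) y ≡ γ
    upd-second x≢y with y ≟ˣ x | y ≟ˣ y
    ... | yes p | _     = ⊥-elim (x≢y (sym p))
    ... | no _  | yes _ = refl
    ... | no _  | no ¬p = ⊥-elim (¬p refl)

    upd-other : ∀ {z} → x ≢ z → y ≢ z → (χ [ x ≔ β , y ≔ γ ]) z ≡ χ z
    upd-other {z} x≢z y≢z with z ≟ˣ x | z ≟ˣ y
    ... | yes p | _     = ⊥-elim (x≢z (sym p))
    ... | no _  | yes p = ⊥-elim (y≢z (sym p))
    ... | no _  | no _  = refl

    upd-proper : ∀ M → All (x ≢_) (flat M) → All (y ≢_) (flat M) → Proper χ M → Proper (χ [ x ≔ β , y ≔ γ ]) M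
    upd-proper []      _               _               _        = []
    upd-proper (_ ∷ M) (x₁ ∷ x₂ ∷ xs) (y₁ ∷ y₂ ∷ ys) (p ∷ ps) =
      trans (upd-other x₁ y₁) (trans p (cong not (sym (upd-other x₂ y₂)))) ∷ upd-proper M xs ys ps

  _∈ᴸ?_ : (x : X) (xs : List X) → Dec (x L.∈ xs)
  x ∈ᴸ? xs = any? (x ≟ˣ_) xs

  ∉⇒All≢ : ∀ {x : X} {xs} → x L.∉ xs → All (x ≢_) xs
  ∉⇒All≢ {xs = []}     _ = []
  ∉⇒All≢ {xs = z ∷ zs} p = (λ q → p (here q)) ∷ ∉⇒All≢ (p ∘ there)

  -- M is, up to reordering and reorienting its pairs, (x , b) ∷ M′.
  record Extraction (x : X) (M : List (X × X)) : Set where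
    field
      partner : X
      others  : List (X × X)
      flat↭   : flat M ↭ x ∷ partner ∷ flat others
      proper  : ∀ χ → χ x ≡ not (χ partner) → Proper χ others → Proper χ M

  extract : (x : X) (M : List (X × X)) → x L.∈ flat M → Extraction x M
  extract x ((x , b) ∷ M) (here refl) = record
    { partner = b ; others = M ; flat↭ = ↭-refl ; proper = λ χ p ps → p ∷ ps }
  extract x ((a , x) ∷ M) (there (here refl)) = record
    { partner = a ; others = M ; flat↭ = swap a x ↭-refl
    ; proper = λ χ p ps → trans (sym (Bool.not-involutive (χ a))) (cong not (sym p)) ∷ ps }
  extract x ((a , b) ∷ M) (there (there x∈)) = record
    { partner = partner ; others = (a , b) ∷ others
    ; flat↭ = ↭-trans (↭-++⁺ˡ (a ∷ b ∷ []) flat↭) (shifts (a ∷ b ∷ []) (x ∷ partner ∷ []))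
    ; proper = λ { χ p (q ∷ qs) → q ∷ proper χ p qs } }
    where open Extraction (extract x M x∈)

  -- A path b – x – y – c, alternately in N, M, N, is contracted to a single pair (b , c) of N.
  twoColour : (M N : List (X × X)) → Unique (flat M) → Unique (flat N) → ∃ λ χ → Proper χ M × Proper χ N
  twoColour [] N _ uN = go N uN
    where
    go : (N : List (X × X)) → Unique (flat N) → ∃ λ χ → Proper χ [] × Proper χ N
    go [] _ = (λ _ → true) , [] , []
    go ((x , y) ∷ N) ((x≢y ∷ x∉) ∷ y∉ ∷ u) with go N u
    ... | χ , _ , p = (χ [ x ≔ true , y ≔ false ]) , [] ,
      trans (upd-first χ) (cong not (sym (upd-second χ x≢y))) ∷ upd-proper χ N x∉ y∉ p
  twoColour ((x , y) ∷ M) N ((x≢y ∷ x∉M) ∷ y∉M ∷ uM) uN = result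
    where
    recolour : ∀ χ β → Proper χ M → Proper (χ [ x ≔ β , y ≔ not β ]) ((x , y) ∷ M)
    recolour χ β p = trans (upd-first χ) (trans (sym (Bool.not-involutive β)) (cong not (sym (upd-second χ x≢y))))
      ∷ upd-proper χ M x∉M y∉M p

    result : ∃ λ χ → Proper χ ((x , y) ∷ M) × Proper χ N
    result with x ∈ᴸ? flat N | y ∈ᴸ? flat N
    ... | no x∉ | no y∉ =
      let χ , pM , pN = twoColour M N uM uN in
      χ [ x ≔ true , y ≔ false ] , recolour χ true pM , upd-proper χ N (∉⇒All≢ x∉) (∉⇒All≢ y∉) pN
    -- The alternating path ends at `x`: `c` is coloured with the rest and forces `y`, which forces
    -- `x`.
    ... | no x∉ | yes y∈ with extract y N y∈
    ...   | E with Unique-↭ (Extraction.flat↭ E) uN | All-resp-↭ (Extraction.flat↭ E) (∉⇒All≢ x∉)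
    ...     | (y≢c ∷ y∉N′) ∷ _ ∷ uN′ | _ ∷ x≢c ∷ x∉N′ =
      let open Extraction E renaming (partner to c; others to N′)
          χ , pM , pN = twoColour M N′ uM uN′
          β = χ c
      in χ [ x ≔ β , y ≔ not β ] , recolour χ β pM
       , proper _ (trans (upd-second χ x≢y) (cong not (sym (upd-other χ x≢c y≢c)))) (upd-proper χ N′ x∉N′ y∉N′ pN)
    result | yes x∈ | _ with extract x N x∈
    ...   | E with Unique-↭ (Extraction.flat↭ E) uN
    ...     | (x≢b ∷ x∉N′) ∷ b∉N′ ∷ uN′ with y ∈ᴸ? flat (Extraction.others E) | Extraction.partner E ≟ˣ y
    -- `x` and `y` are paired in both matchings, so they form a component of their own and are
    -- coloured freely.
    ...       | no y∉N′ | yes refl =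
      let open Extraction E renaming (others to N′)
          χ , pM , pN = twoColour M N′ uM uN′
      in χ [ x ≔ true , y ≔ false ] , recolour χ true pM
       , proper _ (trans (upd-first χ) (cong not (sym (upd-second χ x≢y))))
           (upd-proper χ N′ x∉N′ (∉⇒All≢ y∉N′) pN)
    ...       | no y∉N′ | no b≢y =
      let open Extraction E renaming (partner to b; others to N′)
          χ , pM , pN = twoColour M N′ uM uN′
          β = not (χ b)
      in χ [ x ≔ β , y ≔ not β ] , recolour χ β pM
       , proper _ (trans (upd-first χ) (cong not (sym (upd-other χ x≢b (b≢y ∘ sym)))))
           (upd-proper χ N′ x∉N′ (∉⇒All≢ y∉N′) pN)
    ...       | yes y∈N′ | yes refl = ⊥-elim (All.lookup b∉N′ y∈N′ refl)
    ...       | yes y∈N′ | no b≢y with extract y (Extraction.others E) y∈N′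
    ...         | E′ with Unique-↭ (Extraction.flat↭ E′) uN′
                        | All-resp-↭ (Extraction.flat↭ E′) b∉N′ | All-resp-↭ (Extraction.flat↭ E′) x∉N′
    ...           | (y≢c ∷ y∉N″) ∷ c∉N″ ∷ uN″ | _ ∷ b≢c ∷ b∉N″ | _ ∷ x≢c ∷ x∉N″ =
      let open Extraction E renaming (partner to b)
          open Extraction E′ renaming (partner to c; others to N″; proper to proper′)
          χ , pM , pbc∷pN = twoColour M ((b , c) ∷ N″) uM ((b≢c ∷ b∉N″) ∷ c∉N″ ∷ uN″)
          -- The contracted pair makes `b` and `c` opposite; so `y`, which takes the colour of `b`,
          -- is opposite to `c`, while `x` is opposite to `b`.
          β = not (χ b)
      in χ [ x ≔ β , y ≔ not β ] , recolour χ β pM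
       , proper _ (trans (upd-first χ) (cong not (sym (upd-other χ x≢b (b≢y ∘ sym)))))
          (proper′ _ (trans (upd-second χ x≢y) (cong not (trans (cong not (All.head pbc∷pN))
              (trans (Bool.not-involutive _) (sym (upd-other χ x≢c y≢c))))))
            (upd-proper χ N″ x∉N″ y∉N″ (All.tail pbc∷pN)))

-- Even halving along chains of partitions

bit : Bool → ℕ
bit true  = 1
bit false = 0

num : (X → Bool) → List X → ℕ
num P xs = sumOver xs (λ x → bit (P x))

Near : ℕ → ℕ → Set
Near a b = a ≤ suc b × b ≤ suc a

Balanced : (X → Bool) → (X → Bool) → List X → Set
Balanced χ P xs = Near (num (λ x → P x ∧ χ x) xs) (num (λ x → P x ∧ not (χ x)) xs)

Balanced-↭ : ∀ {χ P} {xs ys : List X} → xs ↭ ys → Balanced χ P ys → Balanced χ P xs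
Balanced-↭ p (u , v) = subst₂ Near (sym (sumOver-↭ _ p)) (sym (sumOver-↭ _ p)) (u , v)

num-mono : {P Q : X → Bool} (xs : List X) → (∀ x → P x ≡ true → Q x ≡ true) → num P xs ≤ num Q xs
num-mono {P = P} {Q} xs imp = sumOver-mono xs go
  where
  go : ∀ x → bit (P x) ≤ bit (Q x)
  go x with P x in eq
  ... | false = z≤n
  ... | true rewrite imp x eq = ≤-refl

Balanced-few : ∀ χ P (xs : List X) → num P xs ≤ 1 → Balanced χ P xs
Balanced-few χ P xs le =
  ≤-trans (num-mono xs (λ x → ∧-true (P x) (χ x))) (≤-trans le (s≤s z≤n)) ,
  ≤-trans (num-mono xs (λ x → ∧-true (P x) (not (χ x)))) (≤-trans le (s≤s z≤n))
  where
  ∧-true : ∀ a b → a ∧ b ≡ true → a ≡ true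
  ∧-true true b _ = refl

-- A pair inside the class adds one to each side and a pair outside adds nothing; no pair has just
-- one end in the class.
Balanced-pairs : ∀ χ P (M : List (X × X)) {xs} → All (λ (x , y) → P x ≡ P y) M → Proper χ M →
  Balanced χ P xs → Balanced χ P (flat M ++ xs)
Balanced-pairs χ P []            _        _        bal = bal
Balanced-pairs χ P ((x , y) ∷ M) (e ∷ es) (p ∷ ps) bal =
  near (P x) (P y) (χ x) (χ y) e p (Balanced-pairs χ P M es ps bal)
  where
  near : ∀ a b c d {m n} → a ≡ b → c ≡ not d → Near m n →
    Near (bit (a ∧ c) + (bit (b ∧ d) + m)) (bit (a ∧ not c) + (bit (b ∧ not d) + n))
  near false _ _ false refl refl uv = uv
  near false _ _ true  refl refl uv = uv
  near true  _ _ false refl refl (u , v) = s≤s u , s≤s v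
  near true  _ _ true  refl refl (u , v) = s≤s u , s≤s v

-- A partition given by its quotient map: the classes are the fibres of `key`, and refinement
-- becomes an implication between equalities of keys.
record Level (X : Set) : Set₁ where
  field
    {Key} : Set
    key   : X → Key
    _≟ᵏ_  : DecidableEquality Key

  class : Key → X → Bool
  class v x = does (key x ≟ᵏ v)

open Level

Refines : Level X → Level X → Set
Refines L L′ = ∀ x y → key L x ≡ key L y → key L′ x ≡ key L′ y

module Chains {X : Set} where

  class-cong : (L : Level X) (v : Key L) {x y : X} → key L x ≡ key L y → class L v x ≡ class L v y
  class-cong L v eq = cong (λ k → does (_≟ᵏ_ L k v)) eq

  -- Greedy: an element is paired with a leftover of the same key whenever there is one, so two
  -- leftovers never share a class.
  pairing : (L : Level X) (xs : List X) → ∃ λ M → ∃ λ left →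
    xs ↭ flat M ++ left × All (λ (x , y) → key L x ≡ key L y) M × (∀ v → num (class L v) left ≤ 1)
  pairing L [] = [] , [] , ↭-refl , [] , λ _ → z≤n
  pairing L (x ∷ xs) with pairing L xs
  ... | M , left , perm , same , few with any? (λ z → _≟ᵏ_ L (key L x) (key L z)) left
  ...   | no none = M , x ∷ left , ↭-trans (prep x perm) (↭-sym (shift x (flat M) left)) , same , few′
    where
    few′ : ∀ v → num (class L v) (x ∷ left) ≤ 1
    few′ v with _≟ᵏ_ L (key L x) v
    ... | no _ = few v
    ... | yes refl = ≤-reflexive (cong suc (zeros left none))
      where
      zeros : ∀ ys → ¬ Any (λ z → key L x ≡ key L z) ys → num (class L v) ys ≡ 0
      zeros [] _ = refl
      zeros (y ∷ ys) n with _≟ᵏ_ L (key L y) v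
      ... | yes p = ⊥-elim (n (here (sym p)))
      ... | no _  = zeros ys (n ∘ there)
  ...   | yes some with find some
  ...     | z , z∈ , kz with ∈-∃++ z∈
  ...       | as , bs , refl = (x , z) ∷ M , as ++ bs
            , prep x (↭-trans perm (↭-trans (↭-++⁺ˡ (flat M) (shift z as bs)) (shift z (flat M) (as ++ bs))))
            , kz ∷ same
            , λ v → ≤-trans (≤-trans (m≤n+m _ (bit (class L v z)))
              (≤-reflexive (sym (sumOver-↭ _ (shift z as bs))))) (few v)

  -- The chain runs from fine to coarse. Elements left over at one level are handed to the next, and
  -- pairs formed earlier stay inside a single class of every coarser partition, so they cannot
  -- disturb its balance.
  chainMatching : (Ls : List (Level X)) → AllPairs Refines Ls → (xs : List X) → ∃ λ M → ∃ λ left →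
    xs ↭ flat M ++ left × (∀ χ → Proper χ M → All (λ L → ∀ v → Balanced χ (class L v) xs) Ls)
  chainMatching [] [] xs = [] , xs , ↭-refl , λ _ _ → []
  chainMatching (L ∷ Ls) (refs ∷ chain) xs with pairing L xs
  ... | M , left , perm , same , few with chainMatching Ls chain left
  ...   | N , left′ , perm′ , bal = M ++ N , left′
      , ↭-trans perm (↭-trans (↭-++⁺ˡ (flat M) perm′)
          (↭-trans (↭-sym (++-assoc (flat M) (flat N) left′)) (↭-reflexive (cong (_++ left′) (sym (flat-++ M N))))))
      , λ χ p → let pM = ++⁻ˡ M p ; pN = ++⁻ʳ M p
                    lift : (L′ : Level X) → All (λ (x , y) → key L′ x ≡ key L′ y) M →
                           (∀ v → Balanced χ (class L′ v) left) → ∀ v → Balanced χ (class L′ v) xs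
                    lift L′ eqs b v = Balanced-↭ {χ = χ} {P = class L′ v} perm
                      (Balanced-pairs χ _ M (All.map (class-cong L′ v) eqs) pM (b v))
                in lift L same (λ v → Balanced-few χ _ left (few v))
                   ∷ All.zipWith (λ { {L′} (r , b) → lift L′ (All.map (λ {xy} → r _ _) same) b }) (refs , bal χ pN)

balancedSplit : (_≟ˣ_ : DecidableEquality X) (Ls Ls′ : List (Level X)) → AllPairs Refines Ls →
  AllPairs Refines Ls′ →
  (xs : List X) → Unique xs → ∃ λ χ → All (λ L → ∀ v → Balanced χ (class L v) xs) (Ls ++ Ls′)
balancedSplit _≟ˣ_ Ls Ls′ chain chain′ xs u =
  let M , _ , perm , bal = Chains.chainMatching Ls chain xs
      M′ , _ , perm′ , bal′ = Chains.chainMatching Ls′ chain′ xs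
      χ , p , p′ = TwoColouring.twoColour _≟ˣ_ M M′
        (Unique-++ˡ (flat M) (Unique-↭ perm u)) (Unique-++ˡ (flat M′) (Unique-↭ perm′ u))
  in χ , ++⁺ (bal χ p) (bal′ χ p′)

-- Equitable colourings through a sum-of-squares potential

-- With min u v = m, the pairs are (m + d , m) and (m + s , m + t) with s + t = d.
sumOfSquares-mono : ∀ m s t → (m + s) * (m + s) + (m + t) * (m + t) ≤ (m + (s + t)) * (m + (s + t)) + m * m
sumOfSquares-mono m s t = subst ((m + s) * (m + s) + (m + t) * (m + t) ≤_) (sym (lem m s t)) (m≤m+n _ _)
  where
  lem : ∀ m s t → (m + (s + t)) * (m + (s + t)) + m * m ≡ ((m + s) * (m + s) + (m + t) * (m + t)) + 2 * (s * t)
  lem = solve-∀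

sumOfSquares-mono-< : ∀ m s t →
  (m + suc s) * (m + suc s) + (m + suc t) * (m + suc t) < (m + (suc s + suc t)) * (m + (suc s + suc t)) + m * m
sumOfSquares-mono-< m s t = subst (suc ((m + suc s) * (m + suc s) + (m + suc t) * (m + suc t)) ≤_)
  (sym (lem m s t)) (s≤s (m≤m+n _ _))
  where
  lem : ∀ m s t → (m + (suc s + suc t)) * (m + (suc s + suc t)) + m * m
    ≡ suc (((m + suc s) * (m + suc s) + (m + suc t) * (m + suc t)) + (1 + 2 * (s + t + s * t)))
  lem = solve-∀

Near-sym : ∀ {a b} → Near a b → Near b a
Near-sym (u , v) = v , u

-- If `a < m`, then `b ≤ suc a ≤ m`, and `a + b` drops below `m + m`.
Near-above : ∀ m d a b → (m + d) + m ≡ a + b → Near a b → m ≤ a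
Near-above m d a b eq (_ , b≤) = ≮⇒≥ λ a<m → <-irrefl (sym eq)
  (<-≤-trans (+-mono-<-≤ a<m (≤-trans b≤ a<m)) (+-monoˡ-≤ m (m≤m+n m d)))

split-excess : ∀ m d a b → (m + d) + m ≡ a + b → m ≤ a → m ≤ b → ∃ λ s → ∃ λ t → a ≡ m + s × b ≡ m + t × s + t ≡ d
split-excess m d a b eq m≤a m≤b with m≤n⇒∃[o]m+o≡n m≤a | m≤n⇒∃[o]m+o≡n m≤b
... | s , refl | t , refl = s , t , refl , refl , sym
  (+-cancelˡ-≡ (m + m) _ _ (trans (lem₁ m d) (trans eq (lem₂ m s t))))
  where
  lem₁ : ∀ m d → (m + m) + d ≡ (m + d) + m
  lem₁ = solve-∀
  lem₂ : ∀ m s t → (m + s) + (m + t) ≡ (m + m) + (s + t)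
  lem₂ = solve-∀

module _ (m d a b : ℕ) (eq : (m + d) + m ≡ a + b) (near : Near a b) where

  private
    excess = split-excess m d a b eq (Near-above m d a b eq near)
      (Near-above m d b a (trans eq (+-comm a b)) (Near-sym near))

  Near-squares-≥ : a * a + b * b ≤ (m + d) * (m + d) + m * m
  Near-squares-≥ with excess
  ... | s , t , refl , refl , refl = sumOfSquares-mono m s t

  -- If one part had no excess over `m`, the other would have all of `d ≥ 2`, against `near`. So
  -- both excesses are positive, and their product gives the strict gain.
  Near-squares-> : 2 ≤ d → a * a + b * b < (m + d) * (m + d) + m * m
  Near-squares-> 2≤d with excess
  ... | zero  , t     , refl , refl , refl = ⊥-elim (<-irrefl refl (≤-trans gap (proj₂ near)))
    where
    gap : suc (suc (m + 0)) ≤ m + t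
    gap = ≤-trans (≤-reflexive (trans (cong (2 +_) (+-identityʳ m)) (+-comm 2 m))) (+-monoʳ-≤ m 2≤d)
  ... | suc s , zero  , refl , refl , refl = ⊥-elim (<-irrefl refl (≤-trans gap (proj₁ near)))
    where
    gap : suc (suc (m + 0)) ≤ m + suc s
    gap = ≤-trans (≤-reflexive (trans (cong (2 +_) (+-identityʳ m)) (+-comm 2 m)))
      (+-monoʳ-≤ m (≤-trans 2≤d (≤-reflexive (+-identityʳ (suc s)))))
  ... | suc s , suc t , refl , refl , refl = sumOfSquares-mono-< m s t

Near-squares : ∀ u v a b → u + v ≡ a + b → Near a b → a * a + b * b ≤ u * u + v * v
Near-squares u v a b eq near with ≤-total v u
... | inj₁ v≤u with m≤n⇒∃[o]m+o≡n v≤u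
...   | d , refl = Near-squares-≥ v d a b eq near
Near-squares u v a b eq near | inj₂ u≤v with m≤n⇒∃[o]m+o≡n u≤v
...   | d , refl = subst (a * a + b * b ≤_) (+-comm ((u + d) * (u + d)) (u * u))
  (Near-squares-≥ u d a b (trans (+-comm (u + d) u) eq) near)

Near-squares-< : ∀ u v a b → suc v < u → u + v ≡ a + b → Near a b → a * a + b * b < u * u + v * v
Near-squares-< u v a b lt eq near with m≤n⇒∃[o]m+o≡n (≤-trans (n≤1+n v) (≤-trans (n≤1+n (suc v)) lt))
... | d , refl = Near-squares-> v d a b eq near
  (+-cancelˡ-≤ v _ _ (subst (_≤ v + d) (+-comm 2 v) lt))

sumOver-mono-∈ : {f g : A → ℕ} {xs : List A} → All (λ x → f x ≤ g x) xs → sumOver xs f ≤ sumOver xs g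
sumOver-mono-∈ []       = z≤n
sumOver-mono-∈ (p ∷ ps) = +-mono-≤ p (sumOver-mono-∈ ps)

sumOver-mono-< : {f g : A → ℕ} {xs : List A} → All (λ x → f x ≤ g x) xs → Any (λ x → f x < g x) xs →
  sumOver xs f < sumOver xs g
sumOver-mono-< (_ ∷ ps) (here lt) = +-mono-<-≤ lt (sumOver-mono-∈ ps)
sumOver-mono-< (p ∷ ps) (there q) = +-mono-≤-< p (sumOver-mono-< ps q)

-- Each side completes its sum by the two values it lacks; this compares sums that differ in two
-- places without subtraction.
sumOver-replaceTwo : ∀ p (g g′ : Fin p → ℕ) a b → a ≢ b → (∀ c → c ≢ a → c ≢ b → g c ≡ g′ c) →
  sumOver (allFin p) g + (g′ a + g′ b) ≡ sumOver (allFin p) g′ + (g a + g b)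
sumOver-replaceTwo p g g′ a b a≢b other =
  trans (side g g′) (trans (sumOver-cong (allFin p) pointwise) (sym (side g′ g)))
  where
  δ = allFin-enumerates p
  side : ∀ h h′ → sumOver (allFin p) h + (h′ a + h′ b) ≡
    sumOver (allFin p) (λ c → h c + (ind (c F.≟ a) * h′ a + ind (c F.≟ b) * h′ b))
  side h h′ = sym (trans (sumOver-+ (allFin p) h _) (cong (sumOver (allFin p) h +_)
    (trans (sumOver-+ (allFin p) _ _) (cong₂ _+_ (δ a (λ _ → h′ a)) (δ b (λ _ → h′ b))))))
  pointwise : ∀ c → g c + (ind (c F.≟ a) * g′ a + ind (c F.≟ b) * g′ b)
                  ≡ g′ c + (ind (c F.≟ a) * g a + ind (c F.≟ b) * g b)
  pointwise c with c F.≟ a | c F.≟ b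
  ... | yes refl | yes refl = ⊥-elim (a≢b refl)
  ... | yes refl | no _     = lem (g c) (g′ c)
    where lem : ∀ x y → x + (1 * y + 0) ≡ y + (1 * x + 0)
          lem = solve-∀
  ... | no _     | yes refl = lem (g c) (g′ c)
    where lem : ∀ x y → x + (0 + 1 * y) ≡ y + (0 + 1 * x)
          lem = solve-∀
  ... | no c≢a   | no c≢b   = cong (_+ 0) (other c c≢a c≢b)

module Equitable {X : Set} (p : ℕ) (xs : List X) (fam : List (X → Bool))
  (split : {Y : X → Set} (Y? : ∀ x → Dec (Y x)) → ∃ λ χ → All (λ P → Balanced χ P (filter Y? xs)) fam) where

  count : (X → Fin p) → (X → Bool) → Fin p → ℕ
  count κ P c = sumOver xs (λ x → bit (P x) * ind (κ x F.≟ c))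

  -- Repairing one class might spoil another, so progress is measured over all classes at once: an
  -- even re-split of two colours raises no sum of two squares, and it lowers the one of a class
  -- whose counts differed by at least 2.
  potential : (X → Fin p) → ℕ
  potential κ = sumOver fam (λ P → sumOver (allFin p) (λ c → count κ P c * count κ P c))

  Fair : (X → Fin p) → (X → Bool) → Set
  Fair κ P = ∀ a b → count κ P a ≤ suc (count κ P b)

  fair? : ∀ κ P → Dec (Fair κ P)
  fair? κ P = Fin.all? (λ a → Fin.all? (λ b → count κ P a ≤? suc (count κ P b)))

  module Rebalance (κ : X → Fin p) (a b : Fin p) (a≢b : a ≢ b) where

    Y? : ∀ x → Dec (κ x ≡ a ⊎ κ x ≡ b)
    Y? x = (κ x F.≟ a) ⊎-dec (κ x F.≟ b)

    χ = proj₁ (split Y?)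

    balanced : All (λ P → Balanced χ P (filter Y? xs)) fam
    balanced = proj₂ (split Y?)

    recolour : X → Fin p
    recolour x = if does (Y? x) then (if χ x then a else b) else κ x

    count-a : ∀ P → count recolour P a ≡ num (λ x → P x ∧ χ x) (filter Y? xs)
    count-a P = trans (sumOver-cong xs pointwise) (sym (sumOver-filter Y? xs _))
      where
      pointwise : ∀ x → bit (P x) * ind (recolour x F.≟ a) ≡ ind (Y? x) * bit (P x ∧ χ x)
      pointwise x with P x | κ x F.≟ a | κ x F.≟ b | χ x
      ... | false | yes _ | _     | _     = refl
      ... | false | no _  | yes _ | _     = refl
      ... | false | no _  | no _  | _     = refl
      ... | true  | yes _ | _     | true  = trans (*-identityˡ _) (ind-yes (a F.≟ a) refl)
      ... | true  | yes _ | _     | false = trans (*-identityˡ _) (ind-no (b F.≟ a) (a≢b ∘ sym))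
      ... | true  | no _  | yes _ | true  = trans (*-identityˡ _) (ind-yes (a F.≟ a) refl)
      ... | true  | no _  | yes _ | false = trans (*-identityˡ _) (ind-no (b F.≟ a) (a≢b ∘ sym))
      ... | true  | no ¬p | no _  | _     = trans (*-identityˡ _) (ind-no (κ x F.≟ a) ¬p)

    count-b : ∀ P → count recolour P b ≡ num (λ x → P x ∧ not (χ x)) (filter Y? xs)
    count-b P = trans (sumOver-cong xs pointwise) (sym (sumOver-filter Y? xs _))
      where
      pointwise : ∀ x → bit (P x) * ind (recolour x F.≟ b) ≡ ind (Y? x) * bit (P x ∧ not (χ x))
      pointwise x with P x | κ x F.≟ a | κ x F.≟ b | χ x
      ... | false | yes _ | _     | _     = refl
      ... | false | no _  | yes _ | _     = refl
      ... | false | no _  | no _  | _     = refl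
      ... | true  | yes _ | _     | true  = trans (*-identityˡ _) (ind-no (a F.≟ b) a≢b)
      ... | true  | yes _ | _     | false = trans (*-identityˡ _) (ind-yes (b F.≟ b) refl)
      ... | true  | no _  | yes _ | true  = trans (*-identityˡ _) (ind-no (a F.≟ b) a≢b)
      ... | true  | no _  | yes _ | false = trans (*-identityˡ _) (ind-yes (b F.≟ b) refl)
      ... | true  | no _  | no ¬p | _     = trans (*-identityˡ _) (ind-no (κ x F.≟ b) ¬p)

    count-other : ∀ P c → c ≢ a → c ≢ b → count κ P c ≡ count recolour P c
    count-other P c c≢a c≢b = sumOver-cong xs λ x → cong (bit (P x) *_) (pointwise x)
      where
      pointwise : ∀ x → ind (κ x F.≟ c) ≡ ind (recolour x F.≟ c)
      pointwise x with κ x F.≟ a | κ x F.≟ b | χ x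
      ... | yes p | _     | true  = trans (ind-no (κ x F.≟ c) (λ q → c≢a (trans (sym q) p)))
        (sym (ind-no (a F.≟ c) (c≢a ∘ sym)))
      ... | yes p | _     | false = trans (ind-no (κ x F.≟ c) (λ q → c≢a (trans (sym q) p)))
        (sym (ind-no (b F.≟ c) (c≢b ∘ sym)))
      ... | no _  | yes p | true  = trans (ind-no (κ x F.≟ c) (λ q → c≢b (trans (sym q) p)))
        (sym (ind-no (a F.≟ c) (c≢a ∘ sym)))
      ... | no _  | yes p | false = trans (ind-no (κ x F.≟ c) (λ q → c≢b (trans (sym q) p)))
        (sym (ind-no (b F.≟ c) (c≢b ∘ sym)))
      ... | no _  | no _  | _     = refl

    count-a+b : ∀ P → count κ P a + count κ P b ≡ count recolour P a + count recolour P b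
    count-a+b P = trans (sym (sumOver-+ xs _ _)) (trans (sumOver-cong xs λ x →
      trans (sym (*-distribˡ-+ (bit (P x)) _ _)) (trans (cong (bit (P x) *_) (pointwise x))
        (*-distribˡ-+ (bit (P x)) _ _))) (sumOver-+ xs _ _))
      where
      pointwise : ∀ x → ind (κ x F.≟ a) + ind (κ x F.≟ b) ≡ ind (recolour x F.≟ a) + ind (recolour x F.≟ b)
      pointwise x with κ x F.≟ a | κ x F.≟ b | χ x
      ... | yes p | yes q | _     = ⊥-elim (a≢b (trans (sym p) q))
      ... | yes _ | no _  | true  = sym (cong₂ _+_ (ind-yes (a F.≟ a) refl) (ind-no (a F.≟ b) a≢b))
      ... | yes _ | no _  | false = sym (cong₂ _+_ (ind-no (b F.≟ a) (a≢b ∘ sym)) (ind-yes (b F.≟ b) refl))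
      ... | no _  | yes _ | true  = sym (cong₂ _+_ (ind-yes (a F.≟ a) refl) (ind-no (a F.≟ b) a≢b))
      ... | no _  | yes _ | false = sym (cong₂ _+_ (ind-no (b F.≟ a) (a≢b ∘ sym)) (ind-yes (b F.≟ b) refl))
      ... | no ¬p | no ¬q | _     = sym (cong₂ _+_ (ind-no (κ x F.≟ a) ¬p) (ind-no (κ x F.≟ b) ¬q))

    near : ∀ P → Balanced χ P (filter Y? xs) → Near (count recolour P a) (count recolour P b)
    near P bal = subst₂ Near (sym (count-a P)) (sym (count-b P)) bal

    squares : (X → Fin p) → (X → Bool) → Fin p → ℕ
    squares κ P c = count κ P c * count κ P c

    squares-eq : ∀ P → sumOver (allFin p) (squares κ P) + (squares recolour P a + squares recolour P b)
      ≡ sumOver (allFin p) (squares recolour P) + (squares κ P a + squares κ P b)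
    squares-eq P = sumOver-replaceTwo p _ _ a b a≢b
      (λ c c≢a c≢b → cong₂ _*_ (count-other P c c≢a c≢b) (count-other P c c≢a c≢b))

    squares-≤ : ∀ P → Balanced χ P (filter Y? xs) →
      sumOver (allFin p) (squares recolour P) ≤ sumOver (allFin p) (squares κ P)
    squares-≤ P bal = +-cancelʳ-≤ (squares κ P a + squares κ P b) _ _
      (≤-trans (≤-reflexive (sym (squares-eq P))) (+-monoʳ-≤ (sumOver (allFin p) (squares κ P))
        (Near-squares (count κ P a) (count κ P b) _ _ (count-a+b P) (near P bal))))

    squares-< : ∀ P → Balanced χ P (filter Y? xs) → suc (count κ P b) < count κ P a →
      sumOver (allFin p) (squares recolour P) < sumOver (allFin p) (squares κ P)
    squares-< P bal lt = +-cancelʳ-< (squares κ P a + squares κ P b) _ _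
      (≤-<-trans (≤-reflexive (sym (squares-eq P))) (+-monoʳ-< (sumOver (allFin p) (squares κ P))
        (Near-squares-< (count κ P a) (count κ P b) _ _ lt (count-a+b P) (near P bal))))

    potential-< : Any (λ P → suc (count κ P b) < count κ P a) fam → potential recolour < potential κ
    potential-< some = sumOver-mono-< (All.map (λ {P} → squares-≤ P) balanced)
      (strict balanced some)
      where
      strict : ∀ {f} → All (λ P → Balanced χ P (filter Y? xs)) f → Any (λ P → suc (count κ P b) < count κ P a) f →
        Any (λ P → sumOver (allFin p) (squares recolour P) < sumOver (allFin p) (squares κ P)) f
      strict (bal ∷ _)  (here lt) = here (squares-< _ bal lt)
      strict (_ ∷ bals) (there q) = there (strict bals q)

  equitable : (κ : X → Fin p) → ∃ λ κ′ → All (Fair κ′) fam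
  equitable κ = go κ (<-wellFounded (potential κ))
    where
    go : ∀ κ → Acc _<_ (potential κ) → ∃ λ κ′ → All (Fair κ′) fam
    go κ (acc rec) with All.all? (fair? κ) fam
    ... | yes fair = κ , fair
    ... | no unfair with find (¬All⇒Any¬ (fair? κ) fam unfair)
    ...   | P , P∈ , ¬fair with Fin.¬∀⟶∃¬ p _ (λ a → Fin.all? (λ b → count κ P a ≤? suc (count κ P b))) ¬fair
    ...     | a , ¬a with Fin.¬∀⟶∃¬ p _ (λ b → count κ P a ≤? suc (count κ P b)) ¬a
    ...       | b , ¬le = go recolour (rec (potential-< (lose P∈ (≰⇒> ¬le))))
      where
      a≢b : a ≢ b
      a≢b refl = ¬le (n≤1+n _)
      open Rebalance κ a b a≢b

-- Simultaneous rounding by one colour of an equitable colouring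

module _ {E : Set} (p : ℕ) (hs : List E) (Ls Ls′ : List (Level E))
  (chain : AllPairs Refines Ls) (chain′ : AllPairs Refines Ls′) where

  private
    D = length hs

    -- Hinges are positions in `hs`, so that several hinges of the same edge remain distinct.
    pull : Level E → Level (Fin D)
    pull L = record { key = key L ∘ lookup hs ; _≟ᵏ_ = _≟ᵏ_ L }

    pull-chain : ∀ {Ls} → AllPairs Refines Ls → AllPairs Refines (map pull Ls)
    pull-chain c = AllPairs.map⁺ (AllPairs.map (λ r x y → r (lookup hs x) (lookup hs y)) c)

    -- Only keys that occur are listed, which makes the family finite; every other key has an empty
    -- class, fair for trivial reasons.
    classes : Level E → List (Fin D → Bool)
    classes L = map (λ x → class (pull L) (key L (lookup hs x))) (allFin D)

    fam : List (Fin D → Bool)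
    fam = concatMap classes (Ls ++ Ls′)

    split : {Y : Fin D → Set} (Y? : ∀ x → Dec (Y x)) → ∃ λ χ → All (λ P → Balanced χ P (filter Y? (allFin D))) fam
    split Y? with balancedSplit F._≟_ (map pull Ls) (map pull Ls′) (pull-chain chain) (pull-chain chain′)
                    (filter Y? (allFin D)) (Unique.filter⁺ Y? (Unique.allFin⁺ D))
    ... | χ , bal = χ , All.concat⁺ (All.map⁺ (All.map (λ b → All.map⁺ (All.tabulate (λ {x} _ → b _)))
      (All.map⁻ (subst (All _) (sym (map-++ pull Ls Ls′)) bal))))

    open Equitable (suc p) (allFin D) fam split

    module FairClass (κ : Fin D → Fin (suc p))
      (fair : All (λ L → ∀ x → Fair κ (class (pull L) (key L (lookup hs x)))) (Ls ++ Ls′)) where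

      fair-any : (L : Level E) → (∀ x → Fair κ (class (pull L) (key L (lookup hs x)))) → ∀ v → Fair κ
        (class (pull L) v)
      fair-any L f v a b with Fin.any? (λ x → _≟ᵏ_ L (key L (lookup hs x)) v)
      ... | yes (x , refl) = f x a b
      ... | no none = ≤-trans (≤-reflexive (trans (sumOver-cong (allFin D) empty) (sumOver-0 (allFin D)))) z≤n
        where
        empty : ∀ x → bit (class (pull L) v x) * ind (κ x F.≟ a) ≡ 0
        empty x with _≟ᵏ_ L (key L (lookup hs x)) v
        ... | yes p = ⊥-elim (none (x , p))
        ... | no _  = refl

      selected : List E
      selected = map (lookup hs) (filter (λ x → κ x F.≟ zero) (allFin D))

      num-selected : (P : E → Bool) → num P selected ≡ count κ (P ∘ lookup hs) zero
      num-selected P = trans (sumOver-map (lookup hs) zeros (bit ∘ P))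
        (trans (sumOver-filter (λ x → κ x F.≟ zero) (allFin D) _)
        (sumOver-cong (allFin D) λ x → *-comm (ind (κ x F.≟ zero)) (bit (P (lookup hs x)))))
        where zeros = filter (λ x → κ x F.≟ zero) (allFin D)

      num-total : (P : E → Bool) → num P hs ≡ ∑ (suc p) (count κ (P ∘ lookup hs))
      num-total P = trans (sym (sumOver-lookup hs _)) (trans (sumOver-cong (allFin D) one)
        (trans (sumOver-swap (allFin D) (allFin (suc p)) _) (sym (∑≡sumOver (suc p) _))))
        where
        one : ∀ x → bit (P (lookup hs x)) ≡ sumOver (allFin (suc p)) (λ c → bit (P (lookup hs x)) * ind (κ x F.≟ c))
        one x = trans (sym (*-identityʳ _))
          (trans (cong (bit (P (lookup hs x)) *_) (sym (FinSum.enum-one-sym (suc p) (κ x))))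
          (sym (sumOver-*ˡ (allFin (suc p)) (bit (P (lookup hs x))) (λ c → ind (κ x F.≟ c)))))

      ∑-bound : ∀ n (g : Fin n → ℕ) c → (∀ i → g i ≤ c) → ∑ n g ≤ n * c
      ∑-bound zero    g c le = z≤n
      ∑-bound (suc n) g c le = +-mono-≤ (le zero) (∑-bound n (g ∘ suc) c (le ∘ suc))
      ∑-bound′ : ∀ n (g : Fin n → ℕ) c → (∀ i → c ≤ suc (g i)) → n * c ≤ n + ∑ n g
      ∑-bound′ zero    g c le = z≤n
      ∑-bound′ (suc n) g c le = ≤-trans (+-mono-≤ (le zero) (∑-bound′ n (g ∘ suc) c (le ∘ suc)))
        (≤-reflexive (lem (g zero) n _))
        where lem : ∀ a n b → suc a + (n + b) ≡ suc n + (a + b)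
              lem = solve-∀
      -- Each of the other `p` colours has a count within 1 of `t`, so `suc p * t` is off the total
      -- by at most `p`; the strict bounds by `suc p` express this.
      bounds : ∀ L v → Fair κ (class (pull L) v) →
        suc p * num (class L v) selected < num (class L v) hs + suc p ×
        num (class L v) hs < suc p * num (class L v) selected + suc p
      bounds L v f rewrite num-selected (class L v) | num-total (class L v) =
        ≤-trans (s≤s (+-monoʳ-≤ t (∑-bound′ p others t (λ i → f zero (suc i)))))
          (≤-reflexive (lem₁ t p (∑ p others))) ,
        ≤-trans (s≤s (+-monoʳ-≤ t (∑-bound p others (suc t) (λ i → f (suc i) zero)))) (≤-reflexive (lem₂ t p))
        where
        t = count κ (class (pull L) v) zero
        others = λ i → count κ (class (pull L) v) (suc i)
        lem₁ : ∀ t p o → suc (t + (p + o)) ≡ (t + o) + suc p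
        lem₁ = solve-∀
        lem₂ : ∀ t p → suc (t + p * suc t) ≡ (t + p * t) + suc p
        lem₂ = solve-∀

  opaque
    roundingSelection : ∃ λ (ts : List E) → All (λ L → ∀ v →
      suc p * num (class L v) ts < num (class L v) hs + suc p ×
      num (class L v) hs < suc p * num (class L v) ts + suc p) (Ls ++ Ls′)
    roundingSelection with equitable (λ _ → zero)
    ... | κ , fam-fair = selected , All.map (λ {L} f v → bounds L v (fair-any L f v)) fair
      where
      fair : All (λ L → ∀ x → Fair κ (class (pull L) (key L (lookup hs x)))) (Ls ++ Ls′)
      fair = All.map (λ f x → All.lookup (All.map⁻ f) (FinSum.∈-enum D x))
        (All.map⁻ (All.concat⁻ fam-fair))
      open FairClass κ fair

-- Partitions as idempotent maps, and merging of classes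

-- A partition of Fin N is encoded by an idempotent map b sending every element to the representative of its class.
module Partition (N : ℕ) (b : Fin N → Fin N) (b-idem : ∀ e → b (b e) ≡ b e) where

  all : List (Fin N)
  all = allFin N

  open FinSum N

  -- As a weight this turns a sum over all elements into a sum over classes; its own total is the
  -- number of classes.
  rep : Fin N → ℕ
  rep β = ind (b β F.≟ β)

  classSum : (Fin N → ℕ) → Fin N → ℕ
  classSum x β = sumOver all (λ e → ind (b e F.≟ β) * x e)

  classSum-weighted : ∀ (g x : Fin N → ℕ) →
    sumOver all (λ β → rep β * (g β * classSum x β)) ≡ sumOver all (λ e → g (b e) * x e)
  classSum-weighted g x = trans (sumOver-cong all λ β → trans (sym (*-assoc (rep β) (g β) _))
      (sym (sumOver-*ˡ all (rep β * g β) _)))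
    (trans (sumOver-swap all all _)
      (sumOver-cong all λ e → trans (sumOver-cong all λ β → comm (rep β) (g β) (ind (b e F.≟ β)) (x e))
      (trans (enum-sym (b e) (λ β → rep β * g β * x e))
        (trans (cong (λ z → z * g (b e) * x e) (ind-yes (b (b e) F.≟ b e) (b-idem e))) (simp (g (b e)) (x e))))))
    where
    comm : ∀ r g i x → r * g * (i * x) ≡ i * (r * g * x)
    comm = solve-∀
    simp : ∀ g x → 1 * g * x ≡ g * x
    simp = solve-∀

  classSum-total : ∀ x → sumOver all (λ β → rep β * classSum x β) ≡ sumOver all x
  classSum-total x = trans (sumOver-cong all λ β → cong (rep β *_) (sym (*-identityˡ _)))
    (trans (classSum-weighted (λ _ → 1) x) (sumOver-cong all λ e → *-identityˡ (x e)))

  ≤classSum : ∀ x e → x e ≤ classSum x (b e)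
  ≤classSum x e = ≤-trans (≤-reflexive
    (sym (trans (cong (_* x e) (ind-yes (b e F.≟ b e) refl)) (*-identityˡ (x e)))))
    (≤sumOver e (λ e′ → ind (b e′ F.≟ b e) * x e′))

  classSum-mono : ∀ {x y} β → (∀ e → x e ≤ y e) → classSum x β ≤ classSum y β
  classSum-mono β le = sumOver-mono all λ e → *-monoʳ-≤ (ind (b e F.≟ β)) (le e)

  classSum-<⇒∃ : ∀ x y β → classSum x β < classSum y β → ∃ λ e → b e ≡ β × x e < y e
  classSum-<⇒∃ x y β lt with sumOver-<⇒∃ all _ _ lt
  ... | e , _ , lt′ with b e F.≟ β
  ...   | yes eq = e , eq , subst₂ _<_ (*-identityˡ (x e)) (*-identityˡ (y e)) lt′
  ...   | no _   = ⊥-elim (n≮0 lt′)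

  classSum>0⇒∃ : ∀ x β → 1 ≤ classSum x β → ∃ λ e → b e ≡ β × 1 ≤ x e
  classSum>0⇒∃ x β pos = classSum-<⇒∃ (λ _ → 0) x β
    (subst (_< classSum x β) (sym (trans (sumOver-cong all λ e → *-zeroʳ (ind (b e F.≟ β))) (sumOver-0 all))) pos)

  module Merge (t : Fin N → ℕ) (e₀ : Fin N) (hit₀ : 1 ≤ t e₀) where

    Hit : Fin N → Set
    Hit β = 1 ≤ classSum t β

    hit? : ∀ β → Dec (Hit β)
    hit? β = atLeast? 1 (classSum t β)

    hit-of : ∀ e → 1 ≤ t e → Hit (b e)
    hit-of e pos = ≤-trans pos (≤classSum t e)

    redirect : ∀ β → Dec (Hit β) → Fin N
    redirect β (yes _) = b e₀
    redirect β (no _)  = β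

    -- All classes met by the support of `t` become one, named after the class of `e₀`. It serves
    -- twice: for branches joined by a new vertex, and for components joined by a new edge.
    merged : Fin N → Fin N
    merged e = redirect (b e) (hit? (b e))

    merged-hit : ∀ e → Hit (b e) → merged e ≡ b e₀
    merged-hit e h = go (hit? (b e))
      where
      go : (d : Dec (Hit (b e))) → redirect (b e) d ≡ b e₀
      go (yes _) = refl
      go (no ¬h) = ⊥-elim (¬h h)

    merged-miss : ∀ e → ¬ Hit (b e) → merged e ≡ b e
    merged-miss e ¬h = go (hit? (b e))
      where
      go : (d : Dec (Hit (b e))) → redirect (b e) d ≡ b e
      go (yes h) = ⊥-elim (¬h h)
      go (no _)  = refl

    merged-b : ∀ e → merged (b e) ≡ merged e
    merged-b e = cong (λ β → redirect β (hit? β)) (b-idem e)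

    merged-idem : ∀ e → merged (merged e) ≡ merged e
    merged-idem e = case hit? (b e) of λ where
      (yes h) → trans (cong merged (merged-hit e h))
        (trans (trans (merged-b e₀) (merged-hit e₀ (hit-of e₀ hit₀))) (sym (merged-hit e h)))
      (no ¬h) → trans (cong merged (merged-miss e ¬h)) (merged-b e)

    -- A missed class keeps its name, which cannot be `b e₀` because the class of `e₀` is hit.
    merged-same : ∀ e e′ → merged e ≡ merged e′ → b e ≡ b e′ ⊎ (Hit (b e) × Hit (b e′))
    merged-same e e′ eq = case (hit? (b e) ,′ hit? (b e′)) of λ where
      (yes h , yes h′) → inj₂ (h , h′)
      (no ¬h , no ¬h′) → inj₁ (trans (sym (merged-miss e ¬h)) (trans eq (merged-miss e′ ¬h′)))
      (yes h , no ¬h′) → ⊥-elim (¬h′ (subst Hit (trans (sym (merged-hit e h)) (trans eq (merged-miss e′ ¬h′)))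
        (hit-of e₀ hit₀)))
      (no ¬h , yes h′) → ⊥-elim (¬h (subst Hit
        (trans (sym (merged-hit e′ h′)) (trans (sym eq) (merged-miss e ¬h))) (hit-of e₀ hit₀)))

    missed : ℕ
    missed = sumOver all (λ β → rep β * ind (¬? (hit? β)))

    hits : ℕ
    hits = sumOver all (λ β → rep β * ind (hit? β))

    missed+hits : missed + hits ≡ sumOver all rep
    missed+hits = trans (sym (sumOver-+ all _ _)) (sumOver-cong all λ β → trans (sym (*-distribˡ-+ (rep β) _ _))
      (trans (cong (rep β *_) (one (hit? β))) (*-identityʳ _)))
      where
      one : ∀ {P : Set} (d : Dec P) → ind (¬? d) + ind d ≡ 1
      one (yes _) = refl
      one (no _)  = refl

    -- The new representatives are those of the missed classes, together with `b e₀`.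
    merged-count : sumOver all (λ e → ind (merged e F.≟ e)) ≡ missed + 1
    merged-count = trans (sumOver-cong all pointwise)
      (trans (sumOver-+ all _ _) (cong (missed +_) (enum-one (b e₀))))
      where
      pointwise : ∀ e → ind (merged e F.≟ e) ≡ rep e * ind (¬? (hit? e)) + ind (e F.≟ b e₀)
      pointwise e = case (hit? (b e) ,′ (b e F.≟ e)) of λ where
        (yes h , yes eq) → trans (cong (λ z → ind (z F.≟ e)) (merged-hit e h))
          (trans (ind-cong (b e₀ F.≟ e) (e F.≟ b e₀) sym sym)
          (cong₂ _+_ (sym (trans (cong (rep e *_) (ind-no (¬? (hit? e)) (λ ¬h → ¬h (subst Hit eq h))))
            (*-zeroʳ (rep e)))) refl))
        (yes h , no neq) → trans (cong (λ z → ind (z F.≟ e)) (merged-hit e h))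
          (trans (ind-cong (b e₀ F.≟ e) (e F.≟ b e₀) sym sym)
          (cong₂ _+_ (sym (cong₂ _*_ (ind-no (b e F.≟ e) neq) (refl {x = ind (¬? (hit? e))}))) refl))
        (no ¬h , yes eq) → trans (ind-yes (merged e F.≟ e) (trans (merged-miss e ¬h) eq))
          (sym (cong₂ _+_ (cong₂ _*_ (ind-yes (b e F.≟ e) eq)
            (ind-yes (¬? (hit? e)) (λ h → ¬h (subst Hit (sym eq) h))))
            (ind-no (e F.≟ b e₀) (λ eq′ → ¬h (subst Hit (trans (sym eq′) (sym eq)) (hit-of e₀ hit₀))))))
        (no ¬h , no neq) → trans (ind-no (merged e F.≟ e) (neq ∘ trans (sym (merged-miss e ¬h))))
          (sym (cong₂ _+_ (cong₂ _*_ (ind-no (b e F.≟ e) neq) (refl {x = ind (¬? (hit? e))}))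
            (ind-no (e F.≟ b e₀) (λ eq′ → neq (trans (trans (cong b eq′) (b-idem e₀)) (sym eq′))))))

    -- Every class that is hit uses up at least one unit of `t`.
    hits≤ : hits ≤ sumOver all t
    hits≤ = ≤-trans (sumOver-mono all λ β → *-monoʳ-≤ (rep β) (small (hit? β))) (≤-reflexive (classSum-total t))
      where
      small : ∀ {x} (d : Dec (1 ≤ x)) → ind d ≤ x
      small (yes p) = p
      small (no _)  = z≤n

-- Branches of one colour when a vertex is split off

m*n≥1⇒m≥1×n≥1 : ∀ m n → 1 ≤ m * n → 1 ≤ m × 1 ≤ n
m*n≥1⇒m≥1×n≥1 (suc m) (suc n) _ = s≤s z≤n , s≤s z≤n
m*n≥1⇒m≥1×n≥1 (suc m) zero    p = ⊥-elim (n≮0 (subst (1 ≤_) (*-zeroʳ m) p))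

-- In one colour: q counts the hinges of each edge at the vertex of weight suc p that is being split, t those moved
-- to the new vertex, and the classes of b are the branches at the split vertex.
module Branches (N p r : ℕ) (b : Fin N → Fin N) (b-idem : ∀ e → b (b e) ≡ b e) (q t : Fin N → ℕ)
  (t≤q : ∀ e → t e ≤ q e)
  (q-total : sumOver (allFin N) q ≡ suc p * suc r) (t-total : sumOver (allFin N) t ≡ suc r)
  (lower : ∀ β → suc p * Partition.classSum N b b-idem t β < Partition.classSum N b b-idem q β + suc p)
  (nontrivial : sumOver (allFin N) (λ e → ind (atLeast? 2 (Partition.classSum N b b-idem q (b e))) * q e)
    < suc p * sumOver (allFin N) (λ e → ind (atLeast? 2 (Partition.classSum N b b-idem q (b e))) * t e) + suc p)
  (hinged : ∀ β → b β ≡ β → 1 ≤ Partition.classSum N b b-idem q β)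
  (few : sumOver (allFin N) (Partition.rep N b b-idem) ≤ suc p * r + 1)
  (e₀ : Fin N) (hit₀ : 1 ≤ t e₀) where

  open Partition N b b-idem
  open Merge t e₀ hit₀
  open FinSum N

  private
    d τ : Fin N → ℕ
    d = classSum q
    τ = classSum t

    hit-one : ∀ {x} (h : Dec (1 ≤ x)) → x ≤ 1 → ind h ≡ x
    hit-one (yes p) le = ≤-antisym p le
    hit-one (no ¬p) le = sym (n≤0⇒n≡0 (≤-pred (≰⇒> ¬p)))

  -- The new number of branches is `missed + 1`, so this is the bound `few` for the next weight. If
  -- no branch gives two hinges, exactly `suc r` branches are hit and `few` leaves at most `p * r`.
  -- Otherwise the hinges are counted.
  missed-≤ : missed ≤ p * r
  missed-≤ with Fin.any? (λ β → (b β F.≟ β) ×-dec (atLeast? 2 (τ β)))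
  ... | no none = +-cancelʳ-≤ (suc r) _ _
    (≤-trans (≤-reflexive (trans (cong (missed +_) (sym hits≡)) missed+hits)) (≤-trans few (≤-reflexive (lem p r))))
    where
    lem : ∀ p r → suc p * r + 1 ≡ p * r + suc r
    lem = solve-∀
    hits≡ : hits ≡ suc r
    hits≡ = trans (sumOver-cong all λ β → ind-*-cong (b β F.≟ β)
      (λ eq → hit-one (hit? β) (≤-pred (≰⇒> λ two → none (β , eq , two))))) (trans (classSum-total t) t-total)
  -- Missed branches have at least one hinge each, the others at least as many as they give. By
  -- `lower`, a branch giving at least 2 hinges has at least `p` more than it gives, and these `p`
  -- close the gap in the total `suc p * suc r`.
  ... | yes (β₁ , rep₁ , two) = +-cancelˡ-≤ (suc r + p) _ _
    (≤-trans (≤-reflexive sum-eq) (≤-trans (sumOver-mono all pointwise)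
      (≤-reflexive (trans (classSum-total q) (trans q-total (lem p r))))))
    where
    lem : ∀ p r → suc p * suc r ≡ (suc r + p) + p * r
    lem = solve-∀
    sum-eq : (suc r + p) + missed ≡ sumOver all
      (λ β → (rep β * τ β + rep β * ind (¬? (hit? β))) + ind (β F.≟ β₁) * p)
    sum-eq = trans (lem′ (suc r) p missed) (sym (trans (sumOver-+ all _ _) (cong₂ _+_
      (trans (sumOver-+ all _ _) (cong (_+ missed) (trans (classSum-total t) t-total))) (enum β₁ (λ _ → p)))))
      where
      enum = allFin-enumerates N
      lem′ : ∀ a b c → (a + b) + c ≡ (a + c) + b
      lem′ = solve-∀
    big : ∀ τ d → 2 ≤ τ → suc p * τ < d + suc p → (1 * τ + 1 * 0) + 1 * p ≤ 1 * d
    big (suc zero)    d (s≤s ()) _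
    big (suc (suc u)) d _ lt = +-cancelʳ-≤ (suc p) _ _ (≤-trans (≤-trans (m≤m+n _ (p * u)) (≤-reflexive (lem′ p u)))
      (≤-trans lt (≤-reflexive (cong (_+ suc p) (sym (*-identityˡ d))))))
      where
      lem′ : ∀ p u → (((1 * suc (suc u) + 1 * 0) + 1 * p) + suc p) + p * u ≡ suc (suc p * suc (suc u))
      lem′ = solve-∀
    small : ∀ τ d (h : Dec (1 ≤ τ)) → τ ≤ d → 1 ≤ d → (1 * τ + 1 * ind (¬? h)) + 0 ≤ 1 * d
    small τ d (yes _) le _ = ≤-trans (≤-reflexive (lem′ τ)) (≤-trans le (≤-reflexive (sym (*-identityˡ d))))
      where
      lem′ : ∀ τ → (1 * τ + 0) + 0 ≡ τ
      lem′ = solve-∀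
    small zero d (no _) _ pos = ≤-trans pos (≤-reflexive (sym (*-identityˡ d)))
    small (suc τ) d (no ¬h) _ _ = ⊥-elim (¬h (s≤s z≤n))
    pointwise : ∀ β → (rep β * τ β + rep β * ind (¬? (hit? β))) + ind (β F.≟ β₁) * p ≤ rep β * d β
    pointwise β with β F.≟ β₁
    ... | yes refl = subst₂ (λ x y → (x * τ β + x * y) + 1 * p ≤ x * d β) (sym (ind-yes (b β F.≟ β) rep₁))
      (sym (ind-no (¬? (hit? β)) (λ ¬h → ¬h (≤-trans (s≤s z≤n) two)))) (big (τ β) (d β) two (lower β))
    ... | no _ with b β F.≟ β
    ...   | yes eq = small (τ β) (d β) (hit? β) (classSum-mono β t≤q) (hinged β eq)
    ...   | no _   = z≤n

  private
    D ν : ℕ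
    D = sumOver all (λ e → ind (atLeast? 2 (d (b e))) * q e)
    ν = sumOver all (λ β → rep β * ind (atLeast? 2 (d β)))

    D≡ : sumOver all (λ β → rep β * (ind (atLeast? 2 (d β)) * d β)) ≡ D
    D≡ = classSum-weighted (λ β → ind (atLeast? 2 (d β))) q

    -- Trivial branches have exactly one hinge, so `D` exceeds `ν` by the number of all hinges minus
    -- the number of all branches, which is at least `p` by `few`.
    excess : suc p + ν ≤ 1 + D
    excess = +-cancelˡ-≤ (suc p * r) _ _ (≤-trans (≤-reflexive sum-eq) (≤-trans (sumOver-mono all pointwise)
      (≤-trans (≤-reflexive (sumOver-+ all _ _))
        (≤-trans (+-mono-≤ few (≤-reflexive D≡)) (≤-reflexive (+-assoc _ 1 D))))))
      where
      lem : ∀ P r n → P * r + (P + n) ≡ P * suc r + n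
      lem = solve-∀
      sum-eq : suc p * r + (suc p + ν) ≡ sumOver all (λ β → rep β * d β + rep β * ind (atLeast? 2 (d β)))
      sum-eq = trans (lem (suc p) r ν)
        (sym (trans (sumOver-+ all _ _) (cong (_+ ν) (trans (classSum-total q) q-total))))
      go : ∀ d (h : Dec (2 ≤ d)) → 1 ≤ d → 1 * d + 1 * ind h ≤ 1 + 1 * (ind h * d)
      go d (yes _) _ = ≤-reflexive (lem′ d)
        where
        lem′ : ∀ d → 1 * d + 1 ≡ 1 + 1 * (1 * d)
        lem′ = solve-∀
      go (suc zero)    (no _)  _ = ≤-refl
      go (suc (suc d)) (no ¬h) _ = ⊥-elim (¬h (s≤s (s≤s z≤n)))
      pointwise : ∀ β → rep β * d β + rep β * ind (atLeast? 2 (d β)) ≤ rep β + rep β *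
        (ind (atLeast? 2 (d β)) * d β)
      pointwise β with b β F.≟ β
      ... | yes eq = go (d β) (atLeast? 2 (d β)) (hinged β eq)
      ... | no _   = z≤n

    ν≥1 : 1 ≤ D → 1 ≤ ν
    ν≥1 pos with sumOver>0⇒∃ all _ (subst (1 ≤_) (sym D≡) pos)
    ... | β , _ , pos′ with m*n≥1⇒m≥1×n≥1 (rep β) _ pos′
    ...   | r≥1 , rest with m*n≥1⇒m≥1×n≥1 (ind (atLeast? 2 (d β))) (d β) rest
    ...     | i≥1 , _ = ≤-trans (*-mono-≤ r≥1 i≥1) (≤sumOver β (λ β → rep β * ind (atLeast? 2 (d β))))

    -- Used twice: `excess` first gives `D ≥ p ≥ 1`, hence a nontrivial branch, and `ν ≥ 1` then
    -- improves the bound by one.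
    D≥ : 1 ≤ p → suc p ≤ D
    D≥ p≥1 = ≤-pred (≤-trans (≤-reflexive (+-comm 1 (suc p))) (≤-trans (+-monoʳ-≤ (suc p) (ν≥1 D≥1)) excess))
      where
      D≥1 : 1 ≤ D
      D≥1 = ≤-trans p≥1 (≤-pred (≤-trans (m≤m+n (suc p) ν) excess))

    -- This branch keeps the new vertex attached to the old one.
    shared : 1 ≤ p → ∃ λ e → Hit (b e) × t e < q e
    shared p≥1 =
      let e , _ , pos = sumOver>0⇒∃ all _ (n≢0⇒n>0 t-nontrivial≢0)
          nt , hit = m*n≥1⇒m≥1×n≥1 (ind (atLeast? 2 (d (b e)))) (t e) pos
          two = ind>0⇒ (atLeast? 2 (d (b e))) nt
          e′ , same , lt = classSum-<⇒∃ t q (b e) (≰⇒> (strict (τ (b e)) (d (b e)) two (lower (b e))))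
      in e′ , subst Hit (sym same) (hit-of e hit) , lt
      where
      t-nontrivial≢0 : sumOver all (λ e → ind (atLeast? 2 (d (b e))) * t e) ≢ 0
      -- If nothing were taken, the rounding would give `D < suc p`, against `D≥`.
      t-nontrivial≢0 eq = <-irrefl refl (<-≤-trans (subst (λ z → D < suc p * z + suc p) eq nontrivial)
        (≤-trans (≤-reflexive (cong (_+ suc p) (*-zeroʳ (suc p)))) (D≥ p≥1)))
      lem : ∀ p → p * 2 ≡ p + p
      lem = solve-∀
      strict : ∀ τ d → 2 ≤ d → suc p * τ < d + suc p → ¬ d ≤ τ
      -- Taking all `d` hinges would give `p * d < suc p`, impossible for `p ≥ 1` and `d ≥ 2`.
      strict τ d two lt le = <-irrefl refl
        (<-≤-trans (+-cancelˡ-< d (p * d) (suc p) (≤-<-trans (*-monoʳ-≤ (suc p) le) lt))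
        (≤-trans (≤-trans (+-monoˡ-≤ p p≥1) (≤-reflexive (sym (lem p)))) (*-monoʳ-≤ p two)))

  -- The joint branch retains the hinge found by `shared`; a branch that was missed loses none of
  -- its hinges.
  merged-hinged : 1 ≤ p → ∀ β → merged β ≡ β → 1 ≤ sumOver all (λ e → ind (merged e F.≟ β) * (q e ∸ t e))
  merged-hinged p≥1 β fix = case hit? (b β) of λ where
      (yes h) → let e , h′ , lt = shared p≥1
                in witness e (trans (merged-hit e h′) (trans (sym (merged-hit β h)) fix)) lt
      (no ¬h) → let fix′ = trans (sym (merged-miss β ¬h)) fix
                    e , be , pos = classSum>0⇒∃ q β (hinged β fix′)
                    ¬h′ = λ h → ¬h (subst Hit (trans be (sym fix′)) h)
                in witness e (trans (merged-miss e ¬h′) be) (≤-trans (s≤s (≮⇒≥ (¬h′ ∘ hit-of e))) pos)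
    where
    witness : ∀ e → merged e ≡ β → t e < q e → 1 ≤ sumOver all (λ e → ind (merged e F.≟ β) * (q e ∸ t e))
    witness e eq lt = ≤-trans (*-mono-≤ (≤-reflexive (sym (ind-yes (merged e F.≟ β) eq))) (m<n⇒0<n∸m lt))
      (≤sumOver e (λ e → ind (merged e F.≟ β) * (q e ∸ t e)))

-- Enumerating and counting subsets

subsets : ∀ n → List (Subset n)
subsets zero    = [] ∷ []
subsets (suc n) = map (outside ∷_) (subsets n) ++ map (inside ∷_) (subsets n)

sumOver-subsets-suc : ∀ n (f : Subset (suc n) → ℕ) →
  sumOver (subsets (suc n)) f ≡ sumOver (subsets n) (f ∘ (outside ∷_)) + sumOver (subsets n) (f ∘ (inside ∷_))
sumOver-subsets-suc n f = trans (sumOver-++ (map (outside ∷_) (subsets n)) _ f)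
  (cong₂ _+_ (sumOver-map (outside ∷_) (subsets n) f) (sumOver-map (inside ∷_) (subsets n) f))

∑Sub≡sumOver : ∀ n f → ∑Sub n f ≡ sumOver (subsets n) f
∑Sub≡sumOver zero    f = sym (+-identityʳ _)
∑Sub≡sumOver (suc n) f = trans (cong₂ _+_ (∑Sub≡sumOver n _) (∑Sub≡sumOver n _)) (sym (sumOver-subsets-suc n f))

_≟ˢ_ : ∀ {n} → DecidableEquality (Subset n)
_≟ˢ_ = Vec.≡-dec Bool._≟_

subsets-enumerates : ∀ n → Enumerates (subsets n) _≟ˢ_
subsets-enumerates zero [] f = lem (f [])
  where
  lem : ∀ x → 1 * x + 0 ≡ x
  lem = solve-∀
subsets-enumerates (suc n) (outside ∷ S) f = trans (sumOver-subsets-suc n _) (trans (cong₂ _+_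
    (trans (sumOver-cong (subsets n) λ T → cong (_* f (outside ∷ T))
      (ind-cong ((outside ∷ T) ≟ˢ (outside ∷ S)) (T ≟ˢ S) Vec.∷-injectiveʳ (cong (outside ∷_))))
      (subsets-enumerates n S (f ∘ (outside ∷_))))
    (trans (sumOver-cong (subsets n) λ T → cong (_* f (inside ∷ T))
      (ind-no ((inside ∷ T) ≟ˢ (outside ∷ S)) λ ())) (sumOver-0 (subsets n))))
  (+-identityʳ _))
subsets-enumerates (suc n) (inside ∷ S) f = trans (sumOver-subsets-suc n _) (cong₂ _+_
    (trans (sumOver-cong (subsets n) λ T → cong (_* f (outside ∷ T))
      (ind-no ((outside ∷ T) ≟ˢ (inside ∷ S)) λ ())) (sumOver-0 (subsets n)))
    (trans (sumOver-cong (subsets n) λ T → cong (_* f (inside ∷ T))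
      (ind-cong ((inside ∷ T) ≟ˢ (inside ∷ S)) (T ≟ˢ S) Vec.∷-injectiveʳ (cong (inside ∷_))))
      (subsets-enumerates n S (f ∘ (inside ∷_)))))

module SubsetSum (n : ℕ) = Enumeration {xs = subsets n} {_≟ˢ_} (subsets-enumerates n)

subsets-of-size : ∀ n h → sumOver (subsets n) (λ S → ind (∣ S ∣ ≟ h)) ≡ n C h
subsets-of-size zero    zero    = refl
subsets-of-size zero    (suc h) = refl
subsets-of-size (suc n) zero    = trans (sumOver-subsets-suc n _) (cong₂ _+_ (subsets-of-size n zero)
  (trans (sumOver-cong (subsets n) λ S → ind-no (∣ inside ∷ S ∣ ≟ 0) λ ()) (sumOver-0 (subsets n))))
subsets-of-size (suc n) (suc h) = trans (sumOver-subsets-suc n _) (trans (cong₂ _+_ (subsets-of-size n (suc h))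
    (trans (sumOver-cong (subsets n) λ S → ind-cong (∣ inside ∷ S ∣ ≟ suc h) (∣ S ∣ ≟ h) suc-injective
      (cong suc)) (subsets-of-size n h)))
  (trans (+-comm (n C suc h) (n C h)) (nCk+nC[k+1]≡[n+1]C[k+1] n h)))

subsets-through-zero : ∀ n h → sumOver (subsets (suc n)) (λ S → ind (∣ S ∣ ≟ suc h) * ind (zero ∈? S)) ≡ n C h
subsets-through-zero n h = trans (sumOver-subsets-suc n _) (cong₂ _+_
  (trans (sumOver-cong (subsets n) λ S → *-zeroʳ (ind (∣ outside ∷ S ∣ ≟ suc h))) (sumOver-0 (subsets n)))
  (trans (sumOver-cong (subsets n) λ S → trans (*-identityʳ _)
    (ind-cong (∣ inside ∷ S ∣ ≟ suc h) (∣ S ∣ ≟ h) suc-injective (cong suc))) (subsets-of-size n h)))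

∈?-suc : ∀ {n} (v : Fin n) x (S : Subset n) → ind (suc v ∈? (x ∷ S)) ≡ ind (v ∈? S)
∈?-suc v x S = ind-cong (suc v ∈? (x ∷ S)) (v ∈? S) drop-there Vec.there

cardinality : ∀ {n} (S : Subset n) → sumOver (allFin n) (λ v → ind (v ∈? S)) ≡ ∣ S ∣
cardinality {n} S = trans (sym (∑≡sumOver n _)) (go S)
  where
  go : ∀ {n} (S : Subset n) → ∑ n (λ v → ind (v ∈? S)) ≡ ∣ S ∣
  tail : ∀ {n} x (S : Subset n) → ∑ n (λ v → ind (suc v ∈? (x ∷ S))) ≡ ∣ S ∣
  tail {n} x S = trans (trans (∑≡sumOver n _)
    (trans (sumOver-cong (allFin n) λ v → ∈?-suc v x S) (sym (∑≡sumOver n _)))) (go S)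
  go []            = refl
  go (outside ∷ S) = tail outside S
  go (inside ∷ S)  = cong suc (tail inside S)

-- Choosing the hinges of the new vertex

bit-does : {P : Set} (d : Dec P) → bit (does d) ≡ ind d
bit-does (yes _) = refl
bit-does (no _)  = refl

-- For positive `P`: `x` is the floor or the ceiling of `y / P`.
WithinRounding : ℕ → ℕ → ℕ → Set
WithinRounding P x y = P * x < y + P × y < P * x + P

WithinRounding-exact : ∀ p x s → WithinRounding (suc p) x (suc p * s) → x ≡ s
WithinRounding-exact p x s (lo , hi) = ≤-antisym (bound x s lo) (bound s x hi)
  where
  bound : ∀ a b → suc p * a < suc p * b + suc p → a ≤ b
  bound a b lt = ≤-pred (*-cancelˡ-< (suc p) a (suc b)
    (<-≤-trans lt (≤-reflexive (trans (+-comm _ (suc p)) (sym (*-suc (suc p) b))))))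

module _ {E : Set} (_≟ᴱ_ : DecidableEquality E) (es : List E) (enum : Enumerates es _≟ᴱ_) where

  -- Weights become multiplicities: `e` is listed `q e` times, and `t e` counts how often it is
  -- selected.
  weightedRounding : ∀ p (q : E → ℕ) (Ls Ls′ : List (Level E)) → AllPairs Refines Ls → AllPairs Refines Ls′ →
    ∃ λ (t : E → ℕ) → All (λ L → ∀ v → WithinRounding (suc p)
      (sumOver es (λ e → t e * ind (_≟ᵏ_ L (key L e) v))) (sumOver es (λ e → q e * ind (_≟ᵏ_ L (key L e) v))))
        (Ls ++ Ls′)
  weightedRounding p q Ls Ls′ chain chain′ with roundingSelection p
    (concatMap (λ e → replicate (q e) e) es) Ls Ls′ chain chain′
  ... | ts , bounds = t , All.map
    (λ {L} f v → subst₂ (WithinRounding (suc p)) (ts-sum L v) (hs-sum L v) (f v)) bounds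
    where
    t : E → ℕ
    t e = sumOver ts (λ x → ind (x ≟ᴱ e))
    hs = concatMap (λ e → replicate (q e) e) es
    hs-sum : ∀ L v → num (class L v) hs ≡ sumOver es (λ e → q e * ind (_≟ᵏ_ L (key L e) v))
    hs-sum L v = trans (sumOver-concatMap _ es _) (sumOver-cong es λ e → trans (sumOver-replicate (q e) e _)
      (cong (q e *_) (bit-does (_≟ᵏ_ L (key L e) v))))
    ts-sum : ∀ L v → num (class L v) ts ≡ sumOver es (λ e → t e * ind (_≟ᵏ_ L (key L e) v))
    ts-sum L v = trans (sumOver-cong ts λ x → bit-does (_≟ᵏ_ L (key L x) v))
      (sym (Enumeration.sumOver-fibres {xs = es} {_≟ᴱ_} enum ts id (λ e → ind (_≟ᵏ_ L (key L e) v))))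

sumOver-single : ∀ n (i : Fin n) (f : Fin n → ℕ) → (∀ j → j ≢ i → f j ≡ 0) → sumOver (allFin n) f ≡ f i
sumOver-single n i f zeros = trans (sumOver-cong (allFin n) pointwise) (allFin-enumerates n i f)
  where
  pointwise : ∀ j → f j ≡ ind (j F.≟ i) * f j
  pointwise j with j F.≟ i
  ... | yes _  = sym (*-identityˡ (f j))
  ... | no neq = zeros j neq

-- The edges of colour i are indexed by Fin (N i).
module Selection {k : ℕ} (N : Fin k → ℕ) where

  Edge : Set
  Edge = Σ (Fin k) (Fin ∘ N)

  _≟ᴱ_ : DecidableEquality Edge
  _≟ᴱ_ = Product.≡-dec F._≟_ F._≟_

  edges : List Edge
  edges = concatMap (λ i → map (i ,_) (allFin (N i))) (allFin k)

  total : (∀ i → Fin (N i) → ℕ) → ℕ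
  total f = sumOver (allFin k) (λ i → sumOver (allFin (N i)) (f i))

  total-cong : ∀ {f g : ∀ i → Fin (N i) → ℕ} → (∀ i e → f i e ≡ g i e) → total f ≡ total g
  total-cong eq = sumOver-cong (allFin k) λ i → sumOver-cong (allFin (N i)) (eq i)

  total-+ : ∀ (f g : ∀ i → Fin (N i) → ℕ) → total (λ i e → f i e + g i e) ≡ total f + total g
  total-+ f g = trans (sumOver-cong (allFin k) λ i → sumOver-+ (allFin (N i)) (f i) (g i))
    (sumOver-+ (allFin k) _ _)

  total-*ˡ : ∀ c (f : ∀ i → Fin (N i) → ℕ) → total (λ i e → c * f i e) ≡ c * total f
  total-*ˡ c f = trans (sumOver-cong (allFin k) λ i → sumOver-*ˡ (allFin (N i)) c (f i)) (sumOver-*ˡ (allFin k) c _)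

  ≤total : ∀ i e (f : ∀ i → Fin (N i) → ℕ) → f i e ≤ total f
  ≤total i e f = ≤-trans (FinSum.≤sumOver (N i) e (f i)) (FinSum.≤sumOver k i _)

  total-colour : ∀ i (f : ∀ i → Fin (N i) → ℕ) → (∀ j → j ≢ i → ∀ e → f j e ≡ 0) → total f ≡ sumOver
    (allFin (N i)) (f i)
  total-colour i f zeros = sumOver-single k i _ λ j j≢i →
    trans (sumOver-cong (allFin (N j)) (zeros j j≢i)) (sumOver-0 (allFin (N j)))

  sumOver-edges : ∀ (f : Edge → ℕ) → sumOver edges f ≡ total (λ i e → f (i , e))
  sumOver-edges f = trans (sumOver-concatMap _ (allFin k) f)
    (sumOver-cong (allFin k) λ i → sumOver-map (i ,_) (allFin (N i)) f)

  pair-fibre : ∀ i β (x : ∀ i → Fin (N i) → ℕ) (g : ∀ i → Fin (N i) → Fin (N i)) →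
    total (λ j e → x j e * ind ((j , g j e) ≟ᴱ (i , β))) ≡ sumOver (allFin (N i)) (λ e → ind (g i e F.≟ β) * x i e)
  pair-fibre i β x g = trans (total-colour i _ λ j j≢i e → trans
    (cong (x j e *_) (ind-no ((j , g j e) ≟ᴱ (i , β)) (j≢i ∘ cong proj₁))) (*-zeroʳ (x j e)))
    (sumOver-cong (allFin (N i)) λ e → trans (*-comm (x i e) _)
      (cong (_* x i e) (ind-cong ((i , g i e) ≟ᴱ (i , β)) (g i e F.≟ β) (λ { refl → refl }) (cong (i ,_)))))

  edges-enumerates : Enumerates edges _≟ᴱ_
  edges-enumerates (i , e) f = trans (sumOver-edges _)
    (trans (total-cong λ j e′ → *-comm (ind ((j , e′) ≟ᴱ (i , e))) (f (j , e′)))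
    (trans (pair-fibre i e (λ j e′ → f (j , e′)) (λ _ → id)) (allFin-enumerates (N i) e (λ e′ → f (i , e′)))))

  module _ {m l : ℕ} (p : ℕ) (kind : ∀ i → Fin (N i) → Fin m) (S : ∀ i → Fin (N i) → Subset l) (q : ∀ i → Fin (N i) → ℕ)
    (b : ∀ i → Fin (N i) → Fin (N i)) (b-idem : ∀ i e → b i (b i e) ≡ b i e) where

    branchSize : ∀ i → Fin (N i) → ℕ
    branchSize i = Partition.classSum (N i) (b i) (b-idem i) (q i)

    ofType : Fin m → Subset l → ∀ i → Fin (N i) → ℕ
    ofType j T i e = ind (kind i e F.≟ j) * ind (S i e ≟ˢ T)

    -- An edge or a branch must not give too much, and the nontrivial branches together must not
    -- give too little, so these bounds are one-sided. Types and colours keep both sides, since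
    -- their integral shares are to be met exactly.
    record Split : Set where
      field
        t : ∀ i → Fin (N i) → ℕ
        at-edge : ∀ i e → suc p * t i e < q i e + suc p
        at-type : ∀ j T → WithinRounding (suc p) (total (λ i e → ofType j T i e * t i e))
          (total (λ i e → ofType j T i e * q i e))
        at-branch : ∀ i β → suc p * Partition.classSum (N i) (b i) (b-idem i) (t i) β < branchSize i β + suc p
        at-nontrivial : ∀ i → sumOver (allFin (N i)) (λ e → ind (atLeast? 2 (branchSize i (b i e))) * q i e)
          < suc p * sumOver (allFin (N i)) (λ e → ind (atLeast? 2 (branchSize i (b i e))) * t i e) + suc p
        at-colour : ∀ i → WithinRounding (suc p) (sumOver (allFin (N i)) (t i)) (sumOver (allFin (N i)) (q i))

    private
      edgeL typeL branchL nontrivialL colourL : Level Edge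
      edgeL       = record { key = id ; _≟ᵏ_ = _≟ᴱ_ }
      typeL       = record { key = λ (i , e) → kind i e , S i e ; _≟ᵏ_ = Product.≡-dec F._≟_ _≟ˢ_ }
      branchL     = record { key = λ (i , e) → i , b i e ; _≟ᵏ_ = _≟ᴱ_ }
      nontrivialL = record
        { key = λ (i , e) → i , does (atLeast? 2 (branchSize i (b i e))) ; _≟ᵏ_ = Product.≡-dec F._≟_ Bool._≟_ }
      colourL     = record { key = proj₁ ; _≟ᵏ_ = F._≟_ }

      convert : ∀ {x y x′ y′} → x ≡ x′ → y ≡ y′ → WithinRounding (suc p) x y → WithinRounding (suc p) x′ y′
      convert = subst₂ (WithinRounding (suc p))

      type-fibre : ∀ j T (x : ∀ i → Fin (N i) → ℕ) →
        sumOver edges (λ (i , e) → x i e * ind (Product.≡-dec F._≟_ _≟ˢ_ (kind i e , S i e) (j , T)))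
          ≡ total (λ i e → ofType j T i e * x i e)
      type-fibre j T x = trans (sumOver-edges _)
        (total-cong λ i e → trans (*-comm (x i e) _) (cong (_* x i e) (split (kind i e) (S i e))))
        where
        split : ∀ j′ T′ → ind (Product.≡-dec F._≟_ _≟ˢ_ (j′ , T′) (j , T)) ≡ ind (j′ F.≟ j) * ind (T′ ≟ˢ T)
        split j′ T′ = case ((j′ F.≟ j) ,′ (T′ ≟ˢ T)) of λ where
          (yes refl , yes refl) → trans (ind-yes (Product.≡-dec F._≟_ _≟ˢ_ (j , T) (j , T)) refl)
            (sym (cong₂ _*_ (ind-yes (j F.≟ j) refl) (ind-yes (T ≟ˢ T) refl)))
          (no neq , _) → trans (ind-no (Product.≡-dec F._≟_ _≟ˢ_ (j′ , T′) (j , T)) (neq ∘ cong proj₁))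
            (sym (cong₂ _*_ (ind-no (j′ F.≟ j) neq) (refl {x = ind (T′ ≟ˢ T)})))
          (_ , no neq) → trans (ind-no (Product.≡-dec F._≟_ _≟ˢ_ (j′ , T′) (j , T)) (neq ∘ cong proj₂))
            (sym (trans (cong (ind (j′ F.≟ j) *_) (ind-no (T′ ≟ˢ T) neq)) (*-zeroʳ (ind (j′ F.≟ j)))))

      nontrivial-fibre : ∀ i (x : ∀ i → Fin (N i) → ℕ) →
        sumOver edges (λ (j , e) → x j e * ind
          (Product.≡-dec F._≟_ Bool._≟_ (j , does (atLeast? 2 (branchSize j (b j e)))) (i , true)))
          ≡ sumOver (allFin (N i)) (λ e → ind (atLeast? 2 (branchSize i (b i e))) * x i e)
      nontrivial-fibre i x = trans (sumOver-edges _) (trans (total-colour i _ λ j j≢i e →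
          trans (cong (x j e *_) (ind-no (Product.≡-dec F._≟_ Bool._≟_ _ _) (j≢i ∘ cong proj₁))) (*-zeroʳ (x j e)))
        (sumOver-cong (allFin (N i)) λ e → trans (*-comm (x i e) _)
          (cong (_* x i e) (decided (atLeast? 2 (branchSize i (b i e)))))))
        where
        decided : ∀ {P : Set} (d : Dec P) → ind (Product.≡-dec F._≟_ Bool._≟_ (i ,′ does d) (i , true)) ≡ ind d
        decided (yes _) = ind-yes (Product.≡-dec F._≟_ Bool._≟_ (i ,′ true) (i , true)) refl
        decided (no _)  = ind-no (Product.≡-dec F._≟_ Bool._≟_ (i ,′ false) (i , true)) λ ()

      colour-fibre : ∀ i (x : ∀ i → Fin (N i) → ℕ) →
        sumOver edges (λ (j , e) → x j e * ind (j F.≟ i)) ≡ sumOver (allFin (N i)) (x i)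
      colour-fibre i x = trans (sumOver-edges _) (trans (total-colour i _ λ j j≢i e →
          trans (cong (x j e *_) (ind-no (j F.≟ i) j≢i)) (*-zeroʳ (x j e)))
        (sumOver-cong (allFin (N i)) λ e → trans (cong (x i e *_) (ind-yes (i F.≟ i) refl)) (*-identityʳ (x i e))))

    opaque
     select : Split
     select with weightedRounding _≟ᴱ_ edges edges-enumerates p (λ (i , e) → q i e)
       (edgeL ∷ typeL ∷ []) (branchL ∷ nontrivialL ∷ colourL ∷ [])
       (((λ _ _ → cong (key typeL)) ∷ []) ∷ [] ∷ [])
       -- A branch lies in one colour and is nontrivial as a whole, so its key determines the keys
       -- of both coarser partitions.
       (((λ _ _ → cong (λ (i , β) → i , does (atLeast? 2 (branchSize i β)))) ∷ (λ _ _ → cong proj₁) ∷ [])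
         ∷ ((λ _ _ → cong proj₁) ∷ []) ∷ [] ∷ [])
     ... | t , (edge ∷ type ∷ branch ∷ nontrivial ∷ colour ∷ []) = record
       { t = t′
       ; at-edge = λ i e → proj₁ (convert (at t (i , e)) (at (λ (i , e) → q i e) (i , e)) (edge (i , e)))
       ; at-type = λ j T → convert (type-fibre j T t′) (type-fibre j T q) (type (j , T))
       ; at-branch = λ i β → proj₁ (convert (trans (sumOver-edges _) (pair-fibre i β t′ b))
         (trans (sumOver-edges _) (pair-fibre i β q b)) (branch (i , β)))
       ; at-nontrivial = λ i → proj₂ (convert (nontrivial-fibre i t′) (nontrivial-fibre i q)
         (nontrivial (i , true)))
       ; at-colour = λ i → convert (colour-fibre i t′) (colour-fibre i q) (colour i)
       }
       where
       t′ : ∀ i → Fin (N i) → ℕ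
       t′ i e = t (i , e)
       at : ∀ (x : Edge → ℕ) v → sumOver edges (λ e → x e * ind (e ≟ᴱ v)) ≡ x v
       at x v = trans (sumOver-cong edges λ e → *-comm (x e) _) (edges-enumerates v x)

-- Splitting off the vertices one at a time

C-absorption : ∀ n k → suc k * (suc n C suc k) ≡ suc n * (n C k)
C-absorption zero    zero    = refl
C-absorption zero    (suc k) = trans (cong (suc (suc k) *_) (k>n⇒nCk≡0 {1} {suc (suc k)} (s≤s (s≤s z≤n))))
  (*-zeroʳ (suc (suc k)))
C-absorption (suc n) zero    = trans (*-identityˡ _) (trans (sym (nCk+nC[k+1]≡[n+1]C[k+1] (suc n) 0))
  (trans (cong suc (trans (sym (*-identityˡ _)) (C-absorption n 0))) (lem n)))
  where
  lem : ∀ n → suc (suc n * 1) ≡ suc (suc n) * 1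
  lem = solve-∀
C-absorption (suc n) (suc k) = begin
  suc (suc k) * (suc (suc n) C suc (suc k))
    ≡⟨ cong (suc (suc k) *_) (sym (nCk+nC[k+1]≡[n+1]C[k+1] (suc n) (suc k))) ⟩
  suc (suc k) * ((suc n C suc k) + (suc n C suc (suc k)))
    ≡⟨ lem₁ k (suc n C suc k) (suc n C suc (suc k)) ⟩
  (suc n C suc k) + (suc k * (suc n C suc k) + suc (suc k) * (suc n C suc (suc k)))
    ≡⟨ cong ((suc n C suc k) +_) (cong₂ _+_ (C-absorption n k) (C-absorption n (suc k))) ⟩
  (suc n C suc k) + (suc n * (n C k) + suc n * (n C suc k))
    ≡⟨ cong ((suc n C suc k) +_) (trans (sym (*-distribˡ-+ (suc n) (n C k) (n C suc k)))
      (cong (suc n *_) (nCk+nC[k+1]≡[n+1]C[k+1] n k))) ⟩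
  (suc n C suc k) + suc n * (suc n C suc k) ∎
  where
  open ≡-Reasoning
  lem₁ : ∀ k x y → suc (suc k) * (x + y) ≡ x + (suc k * x + suc (suc k) * y)
  lem₁ = solve-∀

side : ℕ → Side
side zero    = outside
side (suc _) = inside

module Detachment {k m : ℕ} (N : Fin k → ℕ) (kind : ∀ i → Fin (N i) → Fin m) (Λ H : Fin m → ℕ) (R : Fin k → ℕ)
  (R≥1 : ∀ i → 1 ≤ R i) (Flag : Fin k → Set) where

  open Selection N

  Share : ∀ {l} i → (Fin (N i) → Subset l) → Fin (N i) → Fin (N i) → Set
  Share i S e e′ = ∃ λ v → v ∈ S e × v ∈ S e′

  -- l vertices have been split off; the amalgamated vertex stands for the remaining p ones, and the edge e
  -- contains it q i e times.
  record State (p l : ℕ) : Set where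
    field
      S       : ∀ i → Fin (N i) → Subset l
      q       : ∀ i → Fin (N i) → ℕ
      b       : ∀ i → Fin (N i) → Fin (N i)
      size    : ∀ i e → q i e + ∣ S i e ∣ ≡ H (kind i e)
      -- An edge of this type still has to choose `x` of the `p` fused vertices, and each choice is
      -- owed `Λ j` copies.
      types   : ∀ j T x → x + ∣ T ∣ ≡ H j → total (λ i e → ind (kind i e F.≟ j) * ind (S i e ≟ˢ T)) ≡ Λ j * (p C x)
      hinges  : ∀ i → sumOver (allFin (N i)) (q i) ≡ p * R i
      degrees : ∀ i v → sumOver (allFin (N i)) (λ e → ind (v ∈? S i e)) ≡ R i
      b-idem  : ∀ i e → b i (b i e) ≡ b i e
      linked  : ∀ i e e′ → b i e ≡ b i e′ → Star (Share i (S i)) e e′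
      -- The restriction to `1 ≤ p` is forced: at weight 0 no hinges are left.
      hinged  : ∀ i → Flag i → 1 ≤ p → ∀ β → b i β ≡ β → 1 ≤ sumOver (allFin (N i))
        (λ e → ind (b i e F.≟ β) * q i e)
      few     : ∀ i → Flag i → sumOver (allFin (N i)) (λ e → ind (b i e F.≟ e)) ≤ p * (R i ∸ 1) + 1

  module Step {p l : ℕ} (state : State (suc p) l) where

    open State state

    private
      sel : Split p kind S q b b-idem
      sel = select p kind S q b b-idem

    open Split sel

    -- If `q i e` exceeded the weight, the binomial coefficient in `types` would vanish, although
    -- the edge itself is counted there.
    q≤ : ∀ i e → q i e ≤ suc p
    q≤ i e = ≮⇒≥ λ p<q → <-irrefl (sym (trans (types (kind i e) (S i e) (q i e) (size i e))
        (trans (cong (Λ (kind i e) *_) (k>n⇒nCk≡0 p<q)) (*-zeroʳ (Λ (kind i e))))))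
      (≤-trans (≤-reflexive (sym (cong₂ _*_ (ind-yes (kind i e F.≟ kind i e) refl)
        (ind-yes (S i e ≟ˢ S i e) refl))))
        (≤total i e (λ i′ e′ → ind (kind i′ e′ F.≟ kind i e) * ind (S i′ e′ ≟ˢ S i e))))

    private
      -- Two hinges would need `q > suc p`. Together with `q≤` this keeps edges sets: no edge
      -- contains the new vertex twice.
      single : ∀ t q → q ≤ suc p → suc p * t < q + suc p → t ≤ 1 × t ≤ q
      single zero          q _  _  = z≤n , z≤n
      single (suc zero)    q _  lt = ≤-refl , +-cancelʳ-< (suc p) 0 q
        (≤-<-trans (≤-reflexive (sym (*-identityʳ (suc p)))) lt)
      single (suc (suc t)) q le lt = ⊥-elim
        (<-irrefl refl (<-≤-trans lt (≤-trans (+-monoˡ-≤ (suc p) le)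
        (≤-trans (m≤m+n _ (suc p * t)) (≤-reflexive (lem p t))))))
        where
        lem : ∀ p t → (suc p + suc p) + suc p * t ≡ suc p * suc (suc t)
        lem = solve-∀

    t≤1 : ∀ i e → t i e ≤ 1
    t≤1 i e = proj₁ (single (t i e) (q i e) (q≤ i e) (at-edge i e))

    t≤q : ∀ i e → t i e ≤ q i e
    t≤q i e = proj₂ (single (t i e) (q i e) (q≤ i e) (at-edge i e))

    t-total : ∀ i → sumOver (allFin (N i)) (t i) ≡ R i
    t-total i = WithinRounding-exact p _ _ (subst (WithinRounding (suc p) _) (hinges i) (at-colour i))

    S′ : ∀ i → Fin (N i) → Subset (suc l)
    S′ i e = side (t i e) ∷ S i e

    q′ : ∀ i → Fin (N i) → ℕ
    q′ i e = q i e ∸ t i e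

    size′ : ∀ i e → q′ i e + ∣ S′ i e ∣ ≡ H (kind i e)
    size′ i e = trans (cong (q′ i e +_) (grow (t i e) (t≤1 i e))) (trans (sym (+-assoc (q′ i e) (t i e) _))
      (trans (cong (_+ ∣ S i e ∣) (m∸n+n≡m (t≤q i e))) (size i e)))
      where
      grow : ∀ t → t ≤ 1 → ∣ side t ∷ S i e ∣ ≡ t + ∣ S i e ∣
      grow zero       _ = refl
      grow (suc zero) _ = refl
      grow (suc (suc t)) (s≤s ())

    private
      type : Fin m → Subset l → ∀ i → Fin (N i) → ℕ
      type j T i e = ind (kind i e F.≟ j) * ind (S i e ≟ˢ T)

      moved : Fin m → Subset l → ℕ
      moved j T = total (λ i e → type j T i e * t i e)

      -- All edges of one type contain the fused vertex equally often, as `size` shows.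
      type-hinges : ∀ j T x → x + ∣ T ∣ ≡ H j → total (λ i e → type j T i e * q i e) ≡ x * (Λ j * (suc p C x))
      type-hinges j T x eq = trans (total-cong λ i e → const i e (kind i e F.≟ j) (S i e ≟ˢ T))
        (trans (total-*ˡ x (type j T)) (cong (x *_) (types j T x eq)))
        where
        const : ∀ i e (d : Dec (kind i e ≡ j)) (d′ : Dec (S i e ≡ T)) → ind d * ind d′ * q i e ≡ x *
          (ind d * ind d′)
        const i e (yes refl) (yes refl) = trans (*-identityˡ (q i e))
          (trans (+-cancelʳ-≡ ∣ T ∣ (q i e) x (trans (size i e) (sym eq))) (sym (*-identityʳ x)))
        const i e (yes _)    (no _)     = sym (*-zeroʳ x)
        const i e (no _)     _          = sym (*-zeroʳ x)

      -- The absorption identity makes the number of hinges of the type a multiple of `suc p`, so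
      -- its rounding is exact.
      moved-suc : ∀ j T x → suc x + ∣ T ∣ ≡ H j → moved j T ≡ Λ j * (p C x)
      moved-suc j T x eq = WithinRounding-exact p _ _ (subst (WithinRounding (suc p) _)
        (trans (type-hinges j T (suc x) eq)
          (trans (lem₁ (suc x) (Λ j) (suc p C suc x))
          (trans (cong (Λ j *_) (C-absorption p x)) (lem₂ (Λ j) (suc p) (p C x)))))
        (at-type j T))
        where
        lem₁ : ∀ x λ′ c → x * (λ′ * c) ≡ λ′ * (x * c)
        lem₁ = solve-∀
        lem₂ : ∀ λ′ P c → λ′ * (P * c) ≡ P * (λ′ * c)
        lem₂ = solve-∀

      moved-zero : ∀ j T → ∣ T ∣ ≡ H j → moved j T ≡ 0
      moved-zero j T eq = WithinRounding-exact p _ _ (subst (WithinRounding (suc p) _)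
        (trans (type-hinges j T 0 eq) (sym (*-zeroʳ (suc p)))) (at-type j T))

      type-inside : ∀ j T → total (λ i e → ind (kind i e F.≟ j) * ind (S′ i e ≟ˢ (inside ∷ T))) ≡ moved j T
      type-inside j T = total-cong λ i e → trans (cong (ind (kind i e F.≟ j) *_) (go (t i e) (S i e) (t≤1 i e)))
        (sym (*-assoc (ind (kind i e F.≟ j)) _ (t i e)))
        where
        go : ∀ t U → t ≤ 1 → ind ((side t ∷ U) ≟ˢ (inside ∷ T)) ≡ ind (U ≟ˢ T) * t
        go zero       U _ = trans (ind-no ((outside ∷ U) ≟ˢ (inside ∷ T)) λ ()) (sym (*-zeroʳ (ind (U ≟ˢ T))))
        go (suc zero) U _ = trans (ind-cong ((inside ∷ U) ≟ˢ (inside ∷ T)) (U ≟ˢ T) Vec.∷-injectiveʳ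
          (cong (inside ∷_))) (sym (*-identityʳ (ind (U ≟ˢ T))))
        go (suc (suc t)) U (s≤s ())

      type-outside : ∀ j T → total (λ i e → ind (kind i e F.≟ j) * ind (S′ i e ≟ˢ (outside ∷ T))) + moved j T ≡
        total (type j T)
      type-outside j T = trans (sym (total-+ _ _)) (total-cong λ i e →
        trans (cong (ind (kind i e F.≟ j) * ind (S′ i e ≟ˢ (outside ∷ T)) +_)
          (*-assoc (ind (kind i e F.≟ j)) (ind (S i e ≟ˢ T)) (t i e)))
          (trans (sym (*-distribˡ-+ (ind (kind i e F.≟ j)) (ind (S′ i e ≟ˢ (outside ∷ T)))
            (ind (S i e ≟ˢ T) * t i e)))
            (cong (ind (kind i e F.≟ j) *_) (go (t i e) (S i e) (t≤1 i e)))))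
        where
        go : ∀ t U → t ≤ 1 → ind ((side t ∷ U) ≟ˢ (outside ∷ T)) + ind (U ≟ˢ T) * t ≡ ind (U ≟ˢ T)
        go zero       U _ = trans (cong₂ _+_
          (ind-cong ((outside ∷ U) ≟ˢ (outside ∷ T)) (U ≟ˢ T) Vec.∷-injectiveʳ (cong (outside ∷_)))
          (*-zeroʳ (ind (U ≟ˢ T)))) (+-identityʳ _)
        go (suc zero) U _ = trans (cong₂ _+_ (ind-no ((inside ∷ U) ≟ˢ (outside ∷ T)) λ ())
          (*-identityʳ (ind (U ≟ˢ T)))) refl
        go (suc (suc t)) U (s≤s ())

    -- Edges whose type gains the new vertex are the moved ones; those that avoid it are the rest,
    -- and Pascal's rule gives their number.
    types′ : ∀ j T x → x + ∣ T ∣ ≡ H j → total (λ i e → ind (kind i e F.≟ j) * ind (S′ i e ≟ˢ T)) ≡ Λ j * (p C x)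
    types′ j (inside ∷ T)  x       eq = trans (type-inside j T) (moved-suc j T x (trans (sym (+-suc x ∣ T ∣)) eq))
    types′ j (outside ∷ T) zero    eq = trans
      (trans (sym (+-identityʳ _)) (cong
      (total (λ i e → ind (kind i e F.≟ j) * ind (S′ i e ≟ˢ (outside ∷ T))) +_) (sym (moved-zero j T eq))))
      (trans (type-outside j T) (types j T 0 eq))
    types′ j (outside ∷ T) (suc x) eq = +-cancelʳ-≡ (Λ j * (p C x)) _ _
      (trans (cong (total (λ i e → ind (kind i e F.≟ j) * ind (S′ i e ≟ˢ (outside ∷ T))) +_)
        (sym (moved-suc j T x eq)))
      (trans (type-outside j T) (trans (types j T (suc x) eq)
        (trans (cong (Λ j *_) (sym (nCk+nC[k+1]≡[n+1]C[k+1] p x)))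
        (trans (cong (Λ j *_) (+-comm (p C x) (p C suc x))) (*-distribˡ-+ (Λ j) (p C suc x) (p C x)))))))

    hinges′ : ∀ i → sumOver (allFin (N i)) (q′ i) ≡ p * R i
    hinges′ i = +-cancelˡ-≡ (R i) _ _
      (trans (cong₂ _+_ (sym (t-total i)) refl) (trans (sym (sumOver-+ (allFin (N i)) _ _))
      (trans (sumOver-cong (allFin (N i)) λ e → m+[n∸m]≡n (t≤q i e)) (hinges i))))

    degrees′ : ∀ i v → sumOver (allFin (N i)) (λ e → ind (v ∈? S′ i e)) ≡ R i
    degrees′ i zero    = trans (sumOver-cong (allFin (N i)) λ e → go (t i e) (S i e) (t≤1 i e)) (t-total i)
      where
      go : ∀ t (U : Subset l) → t ≤ 1 → ind (zero ∈? (side t ∷ U)) ≡ t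
      go zero       U _ = refl
      go (suc zero) U _ = refl
      go (suc (suc t)) U (s≤s ())
    degrees′ i (suc v) = trans (sumOver-cong (allFin (N i)) λ e → ∈?-suc v (side (t i e)) (S i e)) (degrees i v)

    private
      new-edge : ∀ i → ∃ λ e → 1 ≤ t i e
      new-edge i =
        let e , _ , pos = sumOver>0⇒∃ (allFin (N i)) (t i) (subst (1 ≤_) (sym (t-total i)) (R≥1 i))
        in e , pos

    module P (i : Fin k) = Partition (N i) (b i) (b-idem i)
    module M (i : Fin k) = Partition.Merge (N i) (b i) (b-idem i) (t i) (proj₁ (new-edge i)) (proj₂ (new-edge i))

    module _ (i : Fin k) (flag : Flag i) where

      private
        sucR : suc (R i ∸ 1) ≡ R i
        sucR = m+[n∸m]≡n (R≥1 i)

      module B = Branches (N i) p (R i ∸ 1) (b i) (b-idem i) (q i) (t i) (t≤q i)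
        (trans (hinges i) (cong (suc p *_) (sym sucR))) (trans (t-total i) (sym sucR))
        (at-branch i) (at-nontrivial i) (hinged i flag (s≤s z≤n)) (few i flag) (proj₁ (new-edge i))
          (proj₂ (new-edge i))

    new-member : ∀ i e → 1 ≤ t i e → zero ∈ S′ i e
    new-member i e pos with t i e
    new-member i e (s≤s _) | suc _ = Vec.here

    -- If two old branches have been merged, each has an edge through the new vertex, and these two
    -- edges share it.
    linked′ : ∀ i e e′ → M.merged i e ≡ M.merged i e′ → Star (Share i (S′ i)) e e′
    linked′ i e e′ eq with M.merged-same i e e′ eq
    ... | inj₁ same = Star.map (λ (v , ∈₁ , ∈₂) → suc v , Vec.there ∈₁ , Vec.there ∈₂) (linked i e e′ same)
    ... | inj₂ (h , h′) =
      let e₁ , same₁ , pos₁ = P.classSum>0⇒∃ i (t i) _ h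
          e₂ , same₂ , pos₂ = P.classSum>0⇒∃ i (t i) _ h′
          old = λ {e e′} → Star.map (λ (v , ∈₁ , ∈₂) → suc v , Vec.there ∈₁ , Vec.there ∈₂) ∘ linked i e e′
      in old (sym same₁) ◅◅ (zero , new-member i e₁ pos₁ , new-member i e₂ pos₂) ◅ old same₂

    next : State p (suc l)
    next = record
      { S = S′ ; q = q′ ; b = M.merged
      ; size = size′ ; types = types′ ; hinges = hinges′ ; degrees = degrees′
      ; b-idem = M.merged-idem ; linked = linked′
      ; hinged = B.merged-hinged
      ; few = λ i flag → ≤-trans (≤-reflexive (M.merged-count i)) (+-monoˡ-≤ 1 (B.missed-≤ i flag))
      }

  detach : ∀ p {l} → State p l → State 0 (p + l)
  detach zero    s = s
  detach (suc p) {l} s = subst (State 0) (+-suc p l) (detach p (Step.next s))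

-- Components and the edge bound for connected hypergraphs

sumOver-const : ∀ n c → sumOver (allFin n) (λ _ → c) ≡ n * c
sumOver-const n c = trans (sym (∑≡sumOver n _)) (go n)
  where
  go : ∀ n → ∑ n (λ _ → c) ≡ n * c
  go zero    = refl
  go (suc n) = cong (c +_) (go n)

*-rotate : ∀ a b c → a * (b * c) ≡ b * (a * c)
*-rotate = solve-∀

-- Freed of subtraction, `enough` bounds the number of classes from below by `n` minus the sum of
-- the sizes less one of the nonempty edges.
record Components (n : ℕ) (Es : List (Subset n)) : Set where
  field
    b        : Fin n → Fin n
    b-idem   : ∀ v → b (b v) ≡ b v
    constant : ∀ {S} → S L.∈ Es → ∀ {u v} → u ∈ S → v ∈ S → b u ≡ b v
    enough   : n + sumOver Es (λ S → ind (atLeast? 1 ∣ S ∣)) ≤ sumOver (allFin n)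
      (λ v → ind (b v F.≟ v)) + sumOver Es ∣_∣

-- A nonempty edge fuses at most as many classes as it has vertices into one; an empty edge changes
-- neither the classes nor the count.
components : ∀ {n} (Es : List (Subset n)) → Components n Es
components {n} [] = record
  { b = id ; b-idem = λ _ → refl ; constant = λ ()
  ; enough = +-monoˡ-≤ 0 (≤-reflexive
    (sym (trans (sumOver-cong (allFin n) λ v → ind-yes (v F.≟ v) refl)
    (trans (sumOver-const n 1) (*-identityʳ n)))))
  }
components {n} (S ∷ Es) with atLeast? 1 ∣ S ∣
... | no empty = record
  { b = b ; b-idem = b-idem
  ; constant = λ where
      (here refl) {u} u∈ _ → ⊥-elim (empty
        (≤-trans (≤-trans (≤-reflexive (sym (ind-yes (u ∈? S) u∈))) (FinSum.≤sumOver n u (λ v → ind (v ∈? S))))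
        (≤-reflexive (cardinality S))))
      (there S∈) → constant S∈
  ; enough = ≤-trans (≤-reflexive (cong (λ z → n + (z + _)) (ind-no (atLeast? 1 ∣ S ∣) empty)))
    (≤-trans enough (+-monoʳ-≤ (sumOver (allFin n) λ v → ind (b v F.≟ v)) (m≤n+m (sumOver Es ∣_∣) ∣ S ∣)))
  }
  where open Components (components Es)
... | yes nonempty = record
  { b = merged ; b-idem = merged-idem
  ; constant = λ where
      (here refl) u∈ v∈ → trans (member u∈) (sym (member v∈))
      (there S∈) u∈ v∈ → cong (λ β → redirect β (hit? β)) (constant S∈ u∈ v∈)
  ; enough = begin
      n + (ind (atLeast? 1 ∣ S ∣) + sumOver Es (λ S → ind (atLeast? 1 ∣ S ∣)))
        ≤⟨ +-monoʳ-≤ n (+-monoˡ-≤ _ (ind≤1 (atLeast? 1 ∣ S ∣))) ⟩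
      n + (1 + sumOver Es (λ S → ind (atLeast? 1 ∣ S ∣)))
        ≡⟨ lem₁ n _ ⟩
      1 + (n + sumOver Es (λ S → ind (atLeast? 1 ∣ S ∣)))
        ≤⟨ +-monoʳ-≤ 1 enough ⟩
      1 + (sumOver (allFin n) rep + sumOver Es ∣_∣)
        ≡⟨ cong (λ z → 1 + (z + sumOver Es ∣_∣)) (sym missed+hits) ⟩
      1 + ((missed + hits) + sumOver Es ∣_∣)
        ≤⟨ +-monoʳ-≤ 1 (+-monoˡ-≤ (sumOver Es ∣_∣)
          (+-monoʳ-≤ missed (≤-trans hits≤ (≤-reflexive (cardinality S))))) ⟩
      1 + ((missed + ∣ S ∣) + sumOver Es ∣_∣)
        ≡⟨ lem₂ missed ∣ S ∣ (sumOver Es ∣_∣) ⟩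
      (missed + 1) + (∣ S ∣ + sumOver Es ∣_∣)
        ≡⟨ cong (_+ (∣ S ∣ + sumOver Es ∣_∣)) (sym merged-count) ⟩
      sumOver (allFin n) (λ v → ind (merged v F.≟ v)) + (∣ S ∣ + sumOver Es ∣_∣) ∎
  }
  where
  open Components (components Es)
  open ≤-Reasoning
  seed : ∃ λ v → v L.∈ allFin n × 1 ≤ ind (v ∈? S)
  seed = sumOver>0⇒∃ (allFin n) (λ v → ind (v ∈? S)) (subst (1 ≤_) (sym (cardinality S)) nonempty)
  open Partition n b b-idem
  open Merge (λ v → ind (v ∈? S)) (proj₁ seed) (proj₂ (proj₂ seed))
  member : ∀ {u} → u ∈ S → merged u ≡ b (proj₁ seed)
  member {u} u∈ = merged-hit u (hit-of u (≤-reflexive (sym (ind-yes (u ∈? S) u∈))))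
  lem₁ : ∀ n x → n + (1 + x) ≡ 1 + (n + x)
  lem₁ = solve-∀
  lem₂ : ∀ m s x → 1 + ((m + s) + x) ≡ (m + 1) + (s + x)
  lem₂ = solve-∀

-- Necessity of the conditions

module Necessity {n m k : ℕ} {Λ : Fin m → ℕ} (H : Fin m → ℕ) (H≥1 : ∀ j → 1 ≤ H j) (R : Fin k → ℕ)
  (f : Assignment n m k Λ) (factor : IsRFactorization H R f) where

  sizeMult : Fin k → Fin m → Subset n → ℕ
  sizeMult i j S = ind (∣ S ∣ ≟ H j) * mult H f i j S

  edgeCount≡ : ∀ i j → edgeCount H f i j ≡ sumOver (subsets n) (sizeMult i j)
  edgeCount≡ i j = ∑Sub≡sumOver n _

  degree≡ : ∀ i v → degree H f i v ≡ sumOver (allFin m)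
    (λ j → sumOver (subsets n) (λ S → ind (v ∈? S) * sizeMult i j S))
  degree≡ i v = trans (∑≡sumOver m _) (sumOver-cong (allFin m) λ j → trans (∑Sub≡sumOver n _)
    (sumOver-cong (subsets n) λ S → lem (ind (∣ S ∣ ≟ H j)) (ind (v ∈? S)) (mult H f i j S)))
    where
    lem : ∀ a b c → a * b * c ≡ b * (a * c)
    lem = solve-∀

  mult-total : ∀ j S → sumOver (allFin k) (λ i → mult H f i j S) ≡ Λ j
  mult-total j S = trans (sumOver-cong (allFin k) λ i → ∑≡sumOver (Λ j) _)
    (trans (sumOver-swap (allFin k) (allFin (Λ j)) _)
    (trans (sumOver-cong (allFin (Λ j)) λ c → FinSum.enum-one-sym k (f j S c))
      (trans (sumOver-const (Λ j) 1) (*-identityʳ (Λ j)))))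

  sizeMult-total : ∀ j S → sumOver (allFin k) (λ i → sizeMult i j S) ≡ ind (∣ S ∣ ≟ H j) * Λ j
  sizeMult-total j S = trans (sumOver-*ˡ (allFin k) (ind (∣ S ∣ ≟ H j)) (λ i → mult H f i j S))
    (cong (ind (∣ S ∣ ≟ H j) *_) (mult-total j S))

  size-weighted : ∀ i j → sumOver (subsets n) (λ S → sizeMult i j S * ∣ S ∣) ≡ edgeCount H f i j * H j
  size-weighted i j = trans (sumOver-cong (subsets n) λ S → go (∣ S ∣ ≟ H j) (mult H f i j S))
    (trans (sumOver-*ʳ (subsets n) (sizeMult i j) (H j)) (cong (_* H j) (sym (edgeCount≡ i j))))
    where
    go : ∀ {x y} (d : Dec (x ≡ y)) z → ind d * z * x ≡ ind d * z * y
    go (yes refl) z = refl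
    go (no _)     z = refl

  -- Incidences of vertices and edges in colour `i` are counted from both sides.
  size-total : ∀ i → sumOver (allFin m) (λ j → sumOver (subsets n) (λ S → sizeMult i j S * ∣ S ∣)) ≡ n * R i
  size-total i = trans (sumOver-cong (allFin m) λ j → trans (sumOver-cong (subsets n) λ S →
        trans (cong (sizeMult i j S *_) (sym (cardinality S)))
          (trans (sym (sumOver-*ˡ (allFin n) (sizeMult i j S) (λ v → ind (v ∈? S))))
          (sumOver-cong (allFin n) λ v → *-comm (sizeMult i j S) _)))
      (sumOver-swap (subsets n) (allFin n) _))
    (trans (sumOver-swap (allFin m) (allFin n) _)
      (trans (sumOver-cong (allFin n) λ v → trans (sym (degree≡ i v)) (factor i v)) (sumOver-const n (R i))))

  matrixCond : MatrixCond n m k Λ H R (edgeCount H f)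
  matrixCond = (λ i → trans (∑≡sumOver m _)
    (trans (sumOver-cong (allFin m) λ j → sym (size-weighted i j)) (size-total i)))
    , λ j → trans (∑≡sumOver k _) (trans (sumOver-cong (allFin k) λ i → edgeCount≡ i j)
        (trans (sumOver-swap (allFin k) (subsets n) _) (trans (sumOver-cong (subsets n) (sizeMult-total j))
          (trans (sumOver-*ʳ (subsets n) _ (Λ j))
            (trans (cong (_* Λ j) (subsets-of-size n (H j))) (*-comm (n C H j) (Λ j)))))))

  degree-total : ∀ v → ∑ k R ≡ sumOver (allFin m)
    (λ j → Λ j * sumOver (subsets n) (λ S → ind (∣ S ∣ ≟ H j) * ind (v ∈? S)))
  degree-total v = trans (∑≡sumOver k R)
    (trans (sumOver-cong (allFin k) λ i → trans (sym (factor i v)) (degree≡ i v))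
    (trans (sumOver-swap (allFin k) (allFin m) _) (sumOver-cong (allFin m) λ j →
      trans (sumOver-swap (allFin k) (subsets n) _) (trans (sumOver-cong (subsets n) λ S →
        trans (sumOver-*ˡ (allFin k) (ind (v ∈? S)) (λ i → sizeMult i j S))
          (trans (cong (ind (v ∈? S) *_) (sizeMult-total j S)) (lem (ind (v ∈? S)) (ind (∣ S ∣ ≟ H j)) (Λ j))))
        (sumOver-*ˡ (subsets n) (Λ j) _)))))
    where
    lem : ∀ a b c → a * (b * c) ≡ c * (b * a)
    lem = solve-∀

  edgeList : Fin k → List (Subset n)
  edgeList i = concatMap (λ j → concatMap (λ S → replicate (sizeMult i j S) S) (subsets n)) (allFin m)

  sumOver-edgeList : ∀ i g → sumOver (edgeList i) g ≡ sumOver (allFin m)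
    (λ j → sumOver (subsets n) (λ S → sizeMult i j S * g S))
  sumOver-edgeList i g = trans (sumOver-concatMap _ (allFin m) g) (sumOver-cong (allFin m) λ j →
    trans (sumOver-concatMap _ (subsets n) g)
      (sumOver-cong (subsets n) λ S → sumOver-replicate (sizeMult i j S) S g))

  edgeCount-total : ∀ i → sumOver (edgeList i) (λ S → ind (atLeast? 1 ∣ S ∣)) ≡ ∑ m (edgeCount H f i)
  edgeCount-total i = trans (sumOver-edgeList i _)
    (trans (sumOver-cong (allFin m) λ j → trans (sumOver-cong (subsets n) λ S →
      drop-nonempty (∣ S ∣ ≟ H j) (mult H f i j S) (H≥1 j)) (sym (edgeCount≡ i j))) (sym (∑≡sumOver m _)))
    where
    drop-nonempty : ∀ {x y} (d : Dec (x ≡ y)) z → 1 ≤ y → ind d * z * ind (atLeast? 1 x) ≡ ind d * z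
    drop-nonempty {x} (yes refl) z pos = trans (cong (1 * z *_) (ind-yes (atLeast? 1 x) pos)) (*-identityʳ (1 * z))
    drop-nonempty     (no _)     z pos = refl

  ∈-edgeList : ∀ {i j S c} → ∣ S ∣ ≡ H j → f j S c ≡ i → S L.∈ edgeList i
  ∈-edgeList {i} {j} {S} {c} size colour = let T , T∈ , pos = found in subst (L._∈ edgeList i)
    (ind>0⇒ (T ≟ˢ S) pos) T∈
    where
    found : ∃ λ T → T L.∈ edgeList i × 1 ≤ ind (T ≟ˢ S)
    found = sumOver>0⇒∃ (edgeList i) (λ T → ind (T ≟ˢ S)) (begin
      1 ≡⟨ sym (cong₂ _*_ (cong₂ _*_ (ind-yes (∣ S ∣ ≟ H j) size) (ind-yes (f j S c F.≟ i) colour))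
        (ind-yes (S ≟ˢ S) refl)) ⟩
      ind (∣ S ∣ ≟ H j) * ind (f j S c F.≟ i) * ind (S ≟ˢ S)
        ≤⟨ *-monoˡ-≤ _ (*-monoʳ-≤ (ind (∣ S ∣ ≟ H j))
          (≤-trans (FinSum.≤sumOver (Λ j) c (λ c → ind (f j S c F.≟ i))) (≤-reflexive (sym (∑≡sumOver (Λ j) _))))) ⟩
      sizeMult i j S * ind (S ≟ˢ S)
        ≤⟨ SubsetSum.≤sumOver n S (λ T → sizeMult i j T * ind (T ≟ˢ S)) ⟩
      sumOver (subsets n) (λ T → sizeMult i j T * ind (T ≟ˢ S))
        ≤⟨ FinSum.≤sumOver m j (λ j → sumOver (subsets n) (λ T → sizeMult i j T * ind (T ≟ˢ S))) ⟩
      sumOver (allFin m) (λ j → sumOver (subsets n) (λ T → sizeMult i j T * ind (T ≟ˢ S)))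
        ≡⟨ sym (sumOver-edgeList i _) ⟩
      sumOver (edgeList i) (λ T → ind (T ≟ˢ S)) ∎)
      where open ≤-Reasoning

  -- The map `b` is constant along adjacency, so connectedness leaves a single class and `enough`
  -- becomes a bound on the number of edges.
  connected-bound : ∀ i → 1 ≤ n → 1 ≤ R i → Connected H f i → ∑ m (edgeCount H f i) ≤ n * (R i ∸ 1) + 1
  connected-bound i n≥1 R≥1 conn = +-cancelˡ-≤ n _ _ (begin
    n + ∑ m (edgeCount H f i)                              ≡⟨ cong (n +_) (sym (edgeCount-total i)) ⟩
    n + sumOver (edgeList i) (λ S → ind (atLeast? 1 ∣ S ∣)) ≤⟨ enough ⟩
    sumOver (allFin n) (λ v → ind (b v F.≟ v)) + sumOver (edgeList i) ∣_∣
      ≡⟨ cong₂ _+_ refl (trans (sumOver-edgeList i _) (size-total i)) ⟩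
    sumOver (allFin n) (λ v → ind (b v F.≟ v)) + n * R i   ≤⟨ +-monoˡ-≤ (n * R i) (one-component n≥1) ⟩
    1 + n * R i                                            ≡⟨ cong (λ r → 1 + n * r) (sym (m+[n∸m]≡n R≥1)) ⟩
    1 + n * suc (R i ∸ 1)                                  ≡⟨ lem n (R i ∸ 1) ⟩
    n + (n * (R i ∸ 1) + 1)                                ∎)
    where
    open ≤-Reasoning
    open Components (components (edgeList i))
    lem : ∀ n r → 1 + n * suc r ≡ n + (n * r + 1)
    lem = solve-∀
    same : ∀ {u v} → Star (Adjacent H f i) u v → b u ≡ b v
    same ε = refl
    same ((j , S , c , size , colour , u∈ , w∈) ◅ rest) = trans
      (constant (∈-edgeList {c = c} size colour) u∈ w∈) (same rest)
    one-component : 1 ≤ n → sumOver (allFin n) (λ v → ind (b v F.≟ v)) ≤ 1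
    one-component (s≤s _) = ≤-trans (sumOver-mono (allFin n) λ v → ≤-reflexive
        (ind-cong (b v F.≟ v) (v F.≟ b zero) (λ p → trans (sym p) (same (conn v zero)))
          (λ p → trans (same (conn v zero)) (sym p))))
      (≤-reflexive (FinSum.enum-one n (b zero)))

-- Both sides are the degree of the vertex `zero` in the whole hypergraph, counted by edge size and
-- by colour.
degreeCond : ∀ {n m k} {Λ : Fin m → ℕ} (H : Fin m → ℕ) (H≥1 : ∀ j → 1 ≤ H j) (R : Fin k → ℕ)
  (f : Assignment (suc n) m k Λ) → IsRFactorization H R f → DegreeCond (suc n) m k Λ H R
degreeCond {n} {m} {k} {Λ} H H≥1 R f factor = trans (∑≡sumOver m _) (trans
    (sumOver-cong (allFin m) λ j → cong (Λ j *_) (sym (through-zero (H j) (H≥1 j))))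
    (sym (Necessity.degree-total H H≥1 R f factor zero)))
  where
  through-zero : ∀ h → 1 ≤ h → sumOver (subsets (suc n)) (λ S → ind (∣ S ∣ ≟ h) * ind (zero ∈? S)) ≡ n C (h ∸ 1)
  through-zero (suc h) _ = subsets-through-zero n h

-- Sufficiency: from the matrix to a factorization

lookupAs : ∀ {L} (xs : List A) → length xs ≡ L → Fin L → A
lookupAs xs refl = lookup xs

sumOver-lookupAs : ∀ {L} (xs : List A) (eq : length xs ≡ L) (g : A → ℕ) → ∑ L (g ∘ lookupAs xs eq) ≡ sumOver xs g
sumOver-lookupAs xs refl g = trans (∑≡sumOver (length xs) _) (sumOver-lookup xs g)

∈⇒lookupAs : ∀ {L} (xs : List A) (eq : length xs ≡ L) {x} → x L.∈ xs → ∃ λ c → lookupAs xs eq c ≡ x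
∈⇒lookupAs xs refl x∈ = Any.index x∈ , sym (lookup-index x∈)

length≡sumOver : (xs : List A) → length xs ≡ sumOver xs (λ _ → 1)
length≡sumOver []       = refl
length≡sumOver (x ∷ xs) = cong suc (length≡sumOver xs)

sumOver-two : ∀ n (f : Fin n → ℕ) x y → x ≢ y → 1 ≤ f x → 1 ≤ f y → 2 ≤ sumOver (allFin n) f
sumOver-two n f x y x≢y fx fy = ≤-trans
  (≤-reflexive (sym (trans (sumOver-+ (allFin n) _ _) (cong₂ _+_ (FinSum.enum-one n x) (FinSum.enum-one n y)))))
  (sumOver-mono (allFin n) pointwise)
  where
  pointwise : ∀ z → ind (z F.≟ x) + ind (z F.≟ y) ≤ f z
  pointwise z with z F.≟ x | z F.≟ y
  ... | yes refl | yes refl = ⊥-elim (x≢y refl)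
  ... | yes refl | no _     = fx
  ... | no _     | yes refl = fy
  ... | no _     | no _     = z≤n

module Sufficiency {n m k : ℕ} (n≥1 : 1 ≤ n) (k≥1 : 1 ≤ k) (Λ : Fin m → ℕ) (R : Fin k → ℕ) (R≥1 : ∀ i → 1 ≤ R i)
  (H : Fin m → ℕ) (H≥1 : ∀ j → 1 ≤ H j) (A : Fin k → Fin m → ℕ) (matrix : MatrixCond n m k Λ H R A) where

  kinds : Fin k → List (Fin m)
  kinds i = concatMap (λ j → replicate (A i j) j) (allFin m)

  N : Fin k → ℕ
  N i = length (kinds i)

  kind : ∀ i → Fin (N i) → Fin m
  kind i = lookup (kinds i)

  sumOver-kind : ∀ i g → sumOver (allFin (N i)) (g ∘ kind i) ≡ sumOver (allFin m) (λ j → A i j * g j)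
  sumOver-kind i g = trans (sumOver-lookup (kinds i) g) (trans (sumOver-concatMap _ (allFin m) g)
    (sumOver-cong (allFin m) λ j → sumOver-replicate (A i j) j g))

  count-kind : ∀ i j → sumOver (allFin (N i)) (λ e → ind (kind i e F.≟ j)) ≡ A i j
  count-kind i j = trans (sumOver-kind i (λ j′ → ind (j′ F.≟ j)))
    (trans (sumOver-cong (allFin m) λ j′ → *-comm (A i j′) _) (allFin-enumerates m j (A i)))

  Flag : Fin k → Set
  Flag i = ∑ m (A i) ≤ n * (R i ∸ 1) + 1

  open Detachment N kind Λ H R R≥1 Flag
  open Selection N

  -- With all vertices fused an edge is only a size and a colour, and `A` prescribes how many there
  -- are. The row condition on `A` becomes `hinges`, the column condition `types`, and `few` the
  -- flag.
  initial : State n 0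
  initial = record
    { S = λ _ _ → [] ; q = λ i e → H (kind i e) ; b = λ _ → id
    ; size = λ i e → +-identityʳ _
    ; types = λ where
        j [] x eq → trans (total-cong λ i e → trans (cong (ind (kind i e F.≟ j) *_) (ind-yes ([] ≟ˢ []) refl))
          (*-identityʳ _))
          (trans (sumOver-cong (allFin k) λ i → count-kind i j) (trans (sym (∑≡sumOver k _))
            (trans (proj₂ matrix j) (cong (λ h → Λ j * (n C h)) (trans (sym eq) (+-identityʳ x))))))
    ; hinges = λ i → trans (sumOver-kind i H) (trans (sym (∑≡sumOver m _)) (proj₁ matrix i))
    ; degrees = λ i ()
    ; b-idem = λ _ _ → refl
    ; linked = λ { i e .e refl → ε }
    ; hinged = λ i _ _ β _ → ≤-trans (H≥1 (kind i β)) (≤-reflexive (sym (allFin-enumerates (N i) β (H ∘ kind i))))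
    ; few = λ i flag → ≤-trans (≤-reflexive (trans (sumOver-cong (allFin (N i)) λ e → ind-yes (e F.≟ e) refl)
        (trans (sumOver-kind i (λ _ → 1))
          (trans (sumOver-cong (allFin m) λ j → *-identityʳ (A i j)) (sym (∑≡sumOver m _)))))) flag
    }

  final : State 0 n
  final = subst (State 0) (+-identityʳ n) (detach n initial)

  open State final

  q≡0 : ∀ i e → q i e ≡ 0
  q≡0 i e = n≤0⇒n≡0 (≤-trans (FinSum.≤sumOver (N i) e (q i)) (≤-reflexive (hinges i)))

  S-size : ∀ i e → ∣ S i e ∣ ≡ H (kind i e)
  S-size i e = trans (cong (_+ ∣ S i e ∣) (sym (q≡0 i e))) (size i e)

  ofType? : ∀ j T (x : Edge) → Dec (kind (proj₁ x) (proj₂ x) ≡ j × S (proj₁ x) (proj₂ x) ≡ T)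
  ofType? j T (i , e) = (kind i e F.≟ j) ×-dec (S i e ≟ˢ T)

  -- The list runs through all colours. It has length `Λ j` for sets of size `H j`, so its entries
  -- can colour the labelled copies of `T`.
  copies : Fin m → Subset n → List Edge
  copies j T = filter (ofType? j T) edges

  sumOver-copies : ∀ j T g → sumOver (copies j T) g ≡ total
    (λ i e → ind (kind i e F.≟ j) * ind (S i e ≟ˢ T) * g (i , e))
  sumOver-copies j T g = trans (sumOver-filter (ofType? j T) edges g) (trans (sumOver-edges _)
    (total-cong λ i e → cong (_* g (i , e)) (ind-× (kind i e F.≟ j) (S i e ≟ˢ T))))
    where
    ind-× : ∀ {P Q : Set} (d : Dec P) (d′ : Dec Q) → ind (d ×-dec d′) ≡ ind d * ind d′
    ind-× (yes _) (yes _) = refl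
    ind-× (yes _) (no _)  = refl
    ind-× (no _)  _       = refl

  length-copies : ∀ j T → ∣ T ∣ ≡ H j → length (copies j T) ≡ Λ j
  length-copies j T eq = trans (length≡sumOver (copies j T)) (trans (sumOver-copies j T (λ _ → 1))
    (trans (total-cong λ i e → *-identityʳ _) (trans (types j T 0 eq) (*-identityʳ (Λ j)))))

  colourOf : ∀ j T → Dec (∣ T ∣ ≡ H j) → Fin (Λ j) → Fin k
  colourOf j T (yes eq) c = proj₁ (lookupAs (copies j T) (length-copies j T eq) c)
  -- Sets of the wrong size are never counted; `k≥1` supplies an arbitrary colour.
  colourOf j T (no _)   c = F.fromℕ< k≥1

  f : Assignment n m k Λ
  f j T = colourOf j T (∣ T ∣ ≟ H j)

  -- Carries counts for `f` over to the detached edges: a constant `g` gives the edge counts, and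
  -- membership of a vertex gives the degrees.
  sum-mult : ∀ i j (g : Subset n → ℕ) → sumOver (subsets n) (λ T → ind (∣ T ∣ ≟ H j) * (g T * mult H f i j T))
    ≡ sumOver (allFin (N i)) (λ e → ind (kind i e F.≟ j) * g (S i e))
  sum-mult i j g = trans (sumOver-cong (subsets n) pointwise) (trans (sumOver-swap (subsets n) (allFin (N i)) _)
    (sumOver-cong (allFin (N i)) collapse))
    where
    colour-mult : ∀ T (d : Dec (∣ T ∣ ≡ H j)) → ind d * ∑ (Λ j) (λ c → ind (colourOf j T d c F.≟ i))
      ≡ ind d * sumOver (allFin (N i)) (λ e → ind (kind i e F.≟ j) * ind (S i e ≟ˢ T))
    colour-mult T (no _)   = refl
    colour-mult T (yes eq) = cong (1 *_)
      (trans (sumOver-lookupAs (copies j T) (length-copies j T eq) (λ x → ind (proj₁ x F.≟ i)))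
      (trans (sumOver-copies j T _) (trans
        (total-colour i _ λ i′ i′≢i e → trans
        (cong (ind (kind i′ e F.≟ j) * ind (S i′ e ≟ˢ T) *_) (ind-no (i′ F.≟ i) i′≢i))
        (*-zeroʳ (ind (kind i′ e F.≟ j) * ind (S i′ e ≟ˢ T))))
        (sumOver-cong (allFin (N i)) λ e → trans
          (cong (ind (kind i e F.≟ j) * ind (S i e ≟ˢ T) *_) (ind-yes (i F.≟ i) refl)) (*-identityʳ _)))))
    pointwise : ∀ T → ind (∣ T ∣ ≟ H j) * (g T * mult H f i j T)
      ≡ sumOver (allFin (N i)) (λ e → ind (kind i e F.≟ j) * (ind (S i e ≟ˢ T) * (g T * ind (∣ T ∣ ≟ H j))))
    pointwise T = trans (*-rotate (ind (∣ T ∣ ≟ H j)) (g T) _) (trans (cong (g T *_) (colour-mult T (∣ T ∣ ≟ H j)))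
      (trans (sym (*-assoc (g T) (ind (∣ T ∣ ≟ H j)) _))
        (trans (sym (sumOver-*ˡ (allFin (N i)) (g T * ind (∣ T ∣ ≟ H j)) _))
        (sumOver-cong (allFin (N i)) λ e → lem (g T * ind (∣ T ∣ ≟ H j)) (ind (kind i e F.≟ j))
          (ind (S i e ≟ˢ T))))))
      where
      lem : ∀ x a b → x * (a * b) ≡ a * (b * x)
      lem = solve-∀
    collapse : ∀ e → sumOver (subsets n)
      (λ T → ind (kind i e F.≟ j) * (ind (S i e ≟ˢ T) * (g T * ind (∣ T ∣ ≟ H j)))) ≡ ind (kind i e F.≟ j) * g
      (S i e)
    collapse e = trans (sumOver-*ˡ (subsets n) (ind (kind i e F.≟ j)) _) (ind-*-cong (kind i e F.≟ j) λ where
      refl → trans (SubsetSum.enum-sym n (S i e) (λ T → g T * ind (∣ T ∣ ≟ H j)))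
        (trans (cong (g (S i e) *_) (ind-yes (∣ S i e ∣ ≟ H (kind i e)) (S-size i e))) (*-identityʳ (g (S i e)))))

  edgeCounts : ∀ i j → edgeCount H f i j ≡ A i j
  edgeCounts i j = trans (∑Sub≡sumOver n _)
    (trans (sumOver-cong (subsets n) λ T → cong (ind (∣ T ∣ ≟ H j) *_) (sym (*-identityˡ (mult H f i j T))))
    (trans (sum-mult i j (λ _ → 1)) (trans (sumOver-cong (allFin (N i)) λ e → *-identityʳ _) (count-kind i j))))

  factorization : IsRFactorization H R f
  factorization i v = trans (∑≡sumOver m _) (trans (sumOver-cong (allFin m) λ j → trans (∑Sub≡sumOver n _)
      (trans (sumOver-cong (subsets n) λ T → *-assoc (ind (∣ T ∣ ≟ H j)) (ind (v ∈? T)) (mult H f i j T))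
        (sum-mult i j (λ T → ind (v ∈? T)))))
    (trans (sumOver-swap (allFin m) (allFin (N i)) _)
      (trans (sumOver-cong (allFin (N i)) λ e → FinSum.enum-sym m (kind i e) (λ _ → ind (v ∈? S i e)))
      (degrees i v))))

  ∈⇒Adjacent : ∀ i e {u v} → u ∈ S i e → v ∈ S i e → Adjacent H f i u v
  ∈⇒Adjacent i e u∈ v∈ =
    let c , eq = chosen (∣ S i e ∣ ≟ H (kind i e)) in kind i e , S i e , c , S-size i e , eq , u∈ , v∈
    where
    chosen : (d : Dec (∣ S i e ∣ ≡ H (kind i e))) → ∃ λ c → colourOf (kind i e) (S i e) d c ≡ i
    chosen (no ¬eq) = ⊥-elim (¬eq (S-size i e))
    chosen (yes eq) =
      let c , found = ∈⇒lookupAs (copies (kind i e) (S i e)) (length-copies _ _ eq)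
            (∈-filter⁺ (ofType? (kind i e) (S i e))
              (Enumeration.∈-enum {xs = edges} {_≟ᴱ_} edges-enumerates (i , e)) (refl , refl))
      in c , cong proj₁ found

  connected : ∀ i → Flag i → Connected H f i
  connected i flag u v =
    let e , u∈ = incident u ; e′ , v∈ = incident v
    in path (linked i e e′ (one-branch e e′)) u∈ v∈
    where
    incident : ∀ w → ∃ λ e → w ∈ S i e
    incident w =
      let e , _ , pos = sumOver>0⇒∃ (allFin (N i)) (λ e → ind (w ∈? S i e))
            (subst (1 ≤_) (sym (degrees i w)) (R≥1 i))
      in e , ind>0⇒ (w ∈? S i e) pos
    rep : ∀ e → 1 ≤ ind (b i (b i e) F.≟ b i e)
    rep e = ≤-reflexive (sym (ind-yes (b i (b i e) F.≟ b i e) (b-idem i e)))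
    one-branch : ∀ e e′ → b i e ≡ b i e′
    one-branch e e′ with b i e F.≟ b i e′
    ... | yes eq = eq
    -- At weight 0, `few` allows a single branch, whereas two different representatives would count
    -- as 2.
    ... | no neq = ⊥-elim (<-irrefl refl
      (≤-trans (sumOver-two (N i) (λ x → ind (b i x F.≟ x)) _ _ neq (rep e) (rep e′)) (few i flag)))
    path : ∀ {e e′ u v} → Star (Share i (S i)) e e′ → u ∈ S i e → v ∈ S i e′ → Star (Adjacent H f i) u v
    path ε u∈ v∈ = ∈⇒Adjacent i _ u∈ v∈ ◅ ε
    path ((w , w∈ , w∈′) ◅ rest) u∈ v∈ = ∈⇒Adjacent i _ u∈ w∈ ◅ path rest w∈′ v∈

theorem9p1 : (n m k : ℕ) → 1 ≤ n → 1 ≤ m → 1 ≤ k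
    → (Λ : Fin m → ℕ) → (∀ j → 1 ≤ Λ j)
    → (R : Fin k → ℕ) → (∀ i → 1 ≤ R i)
    → (H : Fin m → ℕ) → (∀ j → 1 ≤ H j) → (∀ j → H j ≤ n) → (∀ j j′ → j F.< j′ → H j < H j′)
    → ((RFactorable n m k Λ H R ⇔ (DegreeCond n m k Λ H R × ∃[ A ] MatrixCond n m k Λ H R A))
    × (∀ (f : Assignment n m k Λ) → IsRFactorization H R f
    → MatrixCond n m k Λ H R (edgeCount H f)
    × (∀ i → Connected H f i → ∑ m (edgeCount H f i) ≤ n * (R i ∸ 1) + 1))
    × (DegreeCond n m k Λ H R → ∀ A → MatrixCond n m k Λ H R A
    → Σ (Assignment n m k Λ) λ f → (IsRFactorization H R f
    × (∀ i j → edgeCount H f i j ≡ A i j)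
    × (∀ i → ∑ m (A i) ≤ n * (R i ∸ 1) + 1 → Connected H f i))))
theorem9p1 n@(suc _) m k n≥1 _ k≥1 Λ _ R R≥1 H H≥1 _ _ =
    mk⇔ (λ (f , factor) → degreeCond H H≥1 R f factor , _ , Necessity.matrixCond H H≥1 R f factor)
        (λ (_ , A , matrix) → let open Sufficiency n≥1 k≥1 Λ R R≥1 H H≥1 A matrix in f , factorization)
  , (λ f factor → let open Necessity H H≥1 R f factor in matrixCond , λ i → connected-bound i n≥1 (R≥1 i))
  , (λ _ A matrix → let open Sufficiency n≥1 k≥1 Λ R R≥1 H H≥1 A matrix in f , factorization , edgeCounts , connected)
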